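{- Let $A, B$ be objects of $\mathcal{E}$ and let $d, d' \in \mathcal{F}([A],[B])$ be diagrams. Then $d = d'$ by the axioms of $\mathcal{F}$ (i.e. they are equal as morphisms of $\mathcal{F}$) if and only if $V^*(d) = V^*(d')$ for every valuation $V$.
   Context: **The category $\mathcal{E}$.** Fix a set $D$ of basic datatypes and a set $O$ of operations, each operation having a domain and a codomain that are finite lists of datatypes. $\mathcal{E}$ is the free cartesian category generated by $D$ (objects) and $O$ (morphisms). That is, it is the free (strict) symmetric monoidal category on these generators equipped with a natural family of symmetric comonoids (copying $\delta_T : T \to T \times T$ and discarding $\bot_T : T \to I$) compatible with the monoidal structure, equivalently with chosen finite products $\times$ and unit $I$. Its objects are finite products of datatypes. A *column permutation* is an isomorphism of $\mathcal{E}$ between products of datatypes which is a composite of symmetries. **Filters.** Fix a set $F$ of filters; each $f \in F$ has an associated object $T_f \in \mathcal{E}$. **The category $\mathcal{F}$.** $\mathcal{F}$ is the free co-cartesian category generated as follows. It is strict symmetric monoidal; write $\oplus$ for its monoidal product, $\sigma$ for its symmetry and $[A_1,\dots,A_n]$ for $[A_1]\oplus\dots\oplus[A_n]$. There is one generating object $[T]$ for each object $T \in \mathcal{E}$, so objects are finite lists of objects of $\mathcal{E}$; the empty list $[\,]$ is the unit. The morphism generators are: - for each $\alpha \in \mathcal{E}(T,U)$, a generator $[\alpha] : [T] \to [U]$; - for each filter $f$ and object $U \in \mathcal{E}$, a generator $[f \times U] : [T_f \times U] \to [T_f \times U, T_f \times U]$. The co-cartesian structure provides natural commutative monoids with structure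 maps $J_T : [T,T] \to [T]$ (union) and $E_T : [\,] \to [T]$ (empty table), making $\oplus$ the coproduct and $[\,]$ initial. *Filter on arbitrary columns.* For a filter $f$, objects $T, U$ of $\mathcal{E}$ and a column permutation $\pi : T \to T_f \times U$, put $f^{\pi} := ([\pi^{ -1}] \oplus [\pi^{ -1}]) \circ [f \times U] \circ [\pi] : [T] \to [T,T]$. The axioms of $\mathcal{F}$, in addition to the co-cartesian axioms, are the following: 1. $[1_T] = 1_{[T]}$ and $[g]\circ[h] = [g\circ h]$ for composable $g,h$ in $\mathcal{E}$. 2. (Merging a filter immediately does nothing) $J_{T_f\times U}\circ [f\times U] = 1_{[T_f \times U]}$. 3. (Filters commute, even with common columns) For all filters $f,g$ and column permutations $\pi : T \to T_f\times U$, $\rho : T \to T_g \times W$: $(g^{\rho}\oplus g^{\rho})\circ f^{\pi} = (1_{[T]} \oplus \sigma_{[T],[T]} \oplus 1_{[T]})\circ (f^{\pi}\oplus f^{\pi})\circ g^{\rho}$. 4. (Disjoint filters and operations commute) For every $\alpha\in\mathcal{E}(U,W)$: $([1_{T_f}\times\alpha]\oplus[1_{T_f}\times\alpha])\circ[f\times U] = [f\times W]\circ[1_{T_f}\times\alpha]$. 5. (Copying and filtering commute) $([\delta_{T_f}\times 1_U]\oplus[\delta_{T_f}\times 1_U])\circ[f\times U] = [f\times (T_f\times U)]\circ[\delta_{T_f}\times 1_U]$. 6. (Filters do not modify data) With $X = T_f\times U$: $(1_{[X]}\oplus [f\times U])\circ[f\times U] = (1_{[X]}\oplus E_X\oplus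 1_{[X]})\circ [f\times U] = ([f\times U]\oplus 1_{[X]})\circ[f\times U]$. **Valuations.** A valuation $V$ is given by: - a set $V(T)$ for each basic datatype $T \in D$, extended to products by $V(A_1\times\dots\times A_n) = V(A_1)\times\dots\times V(A_n)$; - a function $V(\alpha) : V(A)\to V(B)$ for each generating operation $\alpha\in\mathcal{E}(A,B)$, which extends uniquely to all morphisms of $\mathcal{E}$ as a functor to $\mathbf{Set}$ preserving the cartesian structure; - a subset $V(f)\subseteq V(T_f)$ for each filter $f$. Any valuation $V$ defines a functor $V^* : \mathcal{F}\to\mathbf{Set}$, sending $\oplus$ to disjoint union, as follows: - $V^*([A_1,\dots,A_n]) = V(A_1)\sqcup\dots\sqcup V(A_n)$. - $V^*([\alpha]) = V(\alpha)$. - $V^*([f\times U])$ sends $(x,u)\in V(T_f)\times V(U)$ to $\mathrm{inj}_1(x,u)$ if $x\in V(f)$ and to $\mathrm{inj}_2(x,u)$ otherwise. - $V^*(J_T)$ sends $\mathrm{inj}_i(x)$ to $x$. - $V^*(E_T)$ is the unique map from the empty set to $V(T)$. -}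

module Defs where

open import Axiom.ExcludedMiddle using (ExcludedMiddle)
open import Data.List.Base using (List; []; _∷_; [_]; _++_)
open import Data.List.Properties using (++-assoc; ++-identityʳ)
open import Data.List.Relation.Unary.All using (All; []; _∷_)
import Data.List.Relation.Unary.All.Properties as All
open import Data.List.Relation.Unary.Any using (Any; here; there)
import Data.List.Relation.Unary.Any.Properties as Any
open import Data.Product.Base using (_,_; proj₁)
open import Data.Sum.Base as Sum using ([_,_]′)
open import Function.Base using () renaming (_∘_ to _∘′_)
open import Level using (_⊔_; suc)
open import Relation.Binary.PropositionalEquality using (_≡_; refl; sym)
open import Relation.Nullary.Decidable.Core using (yes; no)
open import Relation.Unary using (Pred)

-- Strict symmetric monoidal categories presented by generators and
-- relations.  Objects are lists over X, the tensor product on objects is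
-- _++_ and the unit is [].  Morphisms are the terms of `Hom` taken up to
-- the congruence `_≈_` defined below.

module StrictSMC {a g} (X : Set a) (Gen : List X → List X → Set g) where

  infixr 9 _∘_
  infixr 10 _⊗_

  data Hom : List X → List X → Set (a ⊔ g) where
    gen : ∀ {A B} → Gen A B → Hom A B
    id  : ∀ {A} → Hom A A
    _∘_ : ∀ {A B C} → Hom B C → Hom A B → Hom A C
    _⊗_ : ∀ {A B C D} → Hom A B → Hom C D → Hom (A ++ C) (B ++ D)
    σ   : ∀ A B → Hom (A ++ B) (B ++ A)

  -- _++_ is associative and right unital only propositionally.  `coe p` is
  -- an identity morphism between two spellings of the same object; it adds
  -- no new morphisms, and the monoidal category remains strict.

  coe : ∀ {A B} → A ≡ B → Hom A B
  coe refl = id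

  α : ∀ A B C → Hom ((A ++ B) ++ C) (A ++ (B ++ C))
  α A B C = coe (++-assoc A B C)

  α⁻¹ : ∀ A B C → Hom (A ++ (B ++ C)) ((A ++ B) ++ C)
  α⁻¹ A B C = coe (sym (++-assoc A B C))

  ρ : ∀ A → Hom (A ++ []) A
  ρ A = coe (++-identityʳ A)

  -- 1 ⊗ σ ⊗ 1
  interchange : ∀ A B C D →
                Hom ((A ++ B) ++ (C ++ D)) ((A ++ C) ++ (B ++ D))
  interchange A B C D =
      α⁻¹ A C (B ++ D)
    ∘ (id {A} ⊗ (α C B D ∘ (σ B C ⊗ id {D}) ∘ α⁻¹ B C D))
    ∘ α A B (C ++ D)

  module Congruence {r} (_∼_ : ∀ {A B} → Hom A B → Hom A B → Set r) where

    infix 4 _≈_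

    data _≈_ : ∀ {A B} → Hom A B → Hom A B → Set (a ⊔ g ⊔ r) where
      axiom   : ∀ {A B} {f f′ : Hom A B} → f ∼ f′ → f ≈ f′

      ≈-refl  : ∀ {A B} {f : Hom A B} → f ≈ f
      ≈-sym   : ∀ {A B} {f f′ : Hom A B} → f ≈ f′ → f′ ≈ f
      ≈-trans : ∀ {A B} {f f′ f″ : Hom A B} → f ≈ f′ → f′ ≈ f″ → f ≈ f″
      ∘-cong  : ∀ {A B C} {f f′ : Hom B C} {h h′ : Hom A B} →
                f ≈ f′ → h ≈ h′ → f ∘ h ≈ f′ ∘ h′
      ⊗-cong  : ∀ {A B C D} {f f′ : Hom A B} {h h′ : Hom C D} →
                f ≈ f′ → h ≈ h′ → f ⊗ h ≈ f′ ⊗ h′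

      identityˡ : ∀ {A B} {f : Hom A B} → id ∘ f ≈ f
      identityʳ : ∀ {A B} {f : Hom A B} → f ∘ id ≈ f
      assoc     : ∀ {A B C D} {f : Hom C D} {h : Hom B C} {k : Hom A B} →
                  (f ∘ h) ∘ k ≈ f ∘ (h ∘ k)

      ⊗-id    : ∀ {A B} → id {A} ⊗ id {B} ≈ id {A ++ B}
      ⊗-∘     : ∀ {A B C A′ B′ C′}
                  {f : Hom B C} {h : Hom A B} {f′ : Hom B′ C′} {h′ : Hom A′ B′} →
                (f ∘ h) ⊗ (f′ ∘ h′) ≈ (f ⊗ f′) ∘ (h ⊗ h′)
      ⊗-assoc : ∀ {A B C A′ B′ C′}
                  {f : Hom A A′} {h : Hom B B′} {k : Hom C C′} →
                α A′ B′ C′ ∘ ((f ⊗ h) ⊗ k) ≈ (f ⊗ (h ⊗ k)) ∘ α A B C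
      ⊗-unitˡ : ∀ {A B} {f : Hom A B} → id {[]} ⊗ f ≈ f
      ⊗-unitʳ : ∀ {A B} {f : Hom A B} → ρ B ∘ (f ⊗ id {[]}) ≈ f ∘ ρ A

      σ-natural    : ∀ {A B C D} {f : Hom A B} {h : Hom C D} →
                     σ B D ∘ (f ⊗ h) ≈ (h ⊗ f) ∘ σ A C
      σ-involutive : ∀ {A B} → σ B A ∘ σ A B ≈ id
      σ-unit       : ∀ {A} → σ A [] ≈ ρ A
      σ-hexagon    : ∀ {A B C} →
                     α B C A ∘ σ A (B ++ C) ∘ α A B C ≈
                     (id {B} ⊗ σ A C) ∘ α B A C ∘ (σ A B ⊗ id {C})

  -- Composites of symmetries; `_⁻¹ₚ` is the inverse since σ is involutive.

  data Perm : List X → List X → Set a where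
    idₚ  : ∀ {A} → Perm A A
    _∘ₚ_ : ∀ {A B C} → Perm B C → Perm A B → Perm A C
    _⊗ₚ_ : ∀ {A B C D} → Perm A B → Perm C D → Perm (A ++ C) (B ++ D)
    σₚ   : ∀ A B → Perm (A ++ B) (B ++ A)

  ⌊_⌋ : ∀ {A B} → Perm A B → Hom A B
  ⌊ idₚ ⌋    = id
  ⌊ π ∘ₚ ρ ⌋ = ⌊ π ⌋ ∘ ⌊ ρ ⌋
  ⌊ π ⊗ₚ ρ ⌋ = ⌊ π ⌋ ⊗ ⌊ ρ ⌋
  ⌊ σₚ A B ⌋ = σ A B

  _⁻¹ₚ : ∀ {A B} → Perm A B → Perm B A
  idₚ ⁻¹ₚ      = idₚ
  (π ∘ₚ ρ) ⁻¹ₚ = (ρ ⁻¹ₚ) ∘ₚ (π ⁻¹ₚ)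
  (π ⊗ₚ ρ) ⁻¹ₚ = (π ⁻¹ₚ) ⊗ₚ (ρ ⁻¹ₚ)
  σₚ A B ⁻¹ₚ   = σₚ B A

record Signature ℓ : Set (suc ℓ) where
  field
    Datatype  : Set ℓ
    Operation : Set ℓ
    dom cod   : Operation → List Datatype
    Filter    : Set ℓ
    type      : Filter → List Datatype

module ℰ {ℓ} (S : Signature ℓ) where
  open Signature S

  Obj : Set ℓ
  Obj = List Datatype

  data Gen : Obj → Obj → Set ℓ where
    op      : ∀ o → Gen (dom o) (cod o)
    copy    : ∀ T → Gen T (T ++ T)
    discard : ∀ T → Gen T []

  open StrictSMC Datatype Gen public renaming (_⊗_ to _×_)

  δ : ∀ T → Hom T (T ++ T)
  δ T = gen (copy T)

  ⊥ : ∀ T → Hom T []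
  ⊥ T = gen (discard T)

  infix 4 _∼_

  data _∼_ : ∀ {T U} → Hom T U → Hom T U → Set ℓ where
    δ-assoc   : ∀ {T} → α T T T ∘ (δ T × id {T}) ∘ δ T ∼ (id {T} × δ T) ∘ δ T
    δ-unitˡ   : ∀ {T} → (⊥ T × id {T}) ∘ δ T ∼ id
    δ-unitʳ   : ∀ {T} → ρ T ∘ (id {T} × ⊥ T) ∘ δ T ∼ id
    δ-comm    : ∀ {T} → σ T T ∘ δ T ∼ δ T
    δ-natural : ∀ {T U} {f : Hom T U} → δ U ∘ f ∼ (f × f) ∘ δ T
    ⊥-natural : ∀ {T U} {f : Hom T U} → ⊥ U ∘ f ∼ ⊥ T
    δ-unit    : δ [] ∼ id
    ⊥-unit    : ⊥ [] ∼ id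
    δ-×       : ∀ {T U} → δ (T ++ U) ∼ interchange T T U U ∘ (δ T × δ U)
    ⊥-×       : ∀ {T U} → ⊥ (T ++ U) ∼ ⊥ T × ⊥ U

  open Congruence _∼_ public

module ℱ {ℓ} (S : Signature ℓ) where
  open Signature S
  private module E = ℰ S

  Obj : Set ℓ
  Obj = List E.Obj

  -- Merging and the empty table are given at every object of ℱ, so that
  -- their naturality can be stated; the relations J-⊕, J-unit, E-⊕ and
  -- E-unit reduce them to the case of singletons.

  data Gen : Obj → Obj → Set ℓ where
    arrow  : ∀ {T U} → E.Hom T U → Gen [ T ] [ U ]
    filter : ∀ f U → Gen [ type f ++ U ] ((type f ++ U) ∷ (type f ++ U) ∷ [])
    merge  : ∀ A → Gen (A ++ A) A
    empty  : ∀ A → Gen [] A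

  open StrictSMC E.Obj Gen public renaming (_⊗_ to _⊕_)

  ⟦_⟧ : ∀ {T U} → E.Hom T U → Hom [ T ] [ U ]
  ⟦ h ⟧ = gen (arrow h)

  [_×_] : ∀ f U → Hom [ type f ++ U ] ((type f ++ U) ∷ (type f ++ U) ∷ [])
  [ f × U ] = gen (filter f U)

  J : ∀ A → Hom (A ++ A) A
  J A = gen (merge A)

  E₀ : ∀ A → Hom [] A
  E₀ A = gen (empty A)

  -- f^π
  filterAt : ∀ f {T U} → E.Perm T (type f ++ U) → Hom [ T ] (T ∷ T ∷ [])
  filterAt f {U = U} π =
    (⟦ E.⌊ π E.⁻¹ₚ ⌋ ⟧ ⊕ ⟦ E.⌊ π E.⁻¹ₚ ⌋ ⟧) ∘ [ f × U ] ∘ ⟦ E.⌊ π ⌋ ⟧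

  -- δ_{T_f} × 1_U
  copyFilterColumns : ∀ f U → E.Hom (type f ++ U) (type f ++ (type f ++ U))
  copyFilterColumns f U =
    E.α (type f) (type f) U E.∘ (E.δ (type f) E.× E.id {U})

  infix 4 _∼_

  data _∼_ : ∀ {A B} → Hom A B → Hom A B → Set ℓ where
    J-assoc   : ∀ {A} → J A ∘ (J A ⊕ id {A}) ∼ J A ∘ (id {A} ⊕ J A) ∘ α A A A
    J-unitˡ   : ∀ {A} → J A ∘ (E₀ A ⊕ id {A}) ∼ id
    J-unitʳ   : ∀ {A} → J A ∘ (id {A} ⊕ E₀ A) ∼ ρ A
    J-comm    : ∀ {A} → J A ∘ σ A A ∼ J A
    J-natural : ∀ {A B} {h : Hom A B} → h ∘ J A ∼ J B ∘ (h ⊕ h)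
    E-natural : ∀ {A B} {h : Hom A B} → h ∘ E₀ A ∼ E₀ B
    J-unit    : J [] ∼ id
    E-unit    : E₀ [] ∼ id
    J-⊕       : ∀ {A B} → J (A ++ B) ∼ (J A ⊕ J B) ∘ interchange A B A B
    E-⊕       : ∀ {A B} → E₀ (A ++ B) ∼ E₀ A ⊕ E₀ B

    -- The morphisms of ℰ are terms up to E._≈_, hence arrow-cong.
    arrow-cong : ∀ {T U} {h k : E.Hom T U} → h E.≈ k → ⟦ h ⟧ ∼ ⟦ k ⟧
    arrow-id   : ∀ {T} → ⟦ E.id {T} ⟧ ∼ id
    arrow-∘    : ∀ {T U W} {h : E.Hom U W} {k : E.Hom T U} →
                 ⟦ h ⟧ ∘ ⟦ k ⟧ ∼ ⟦ h E.∘ k ⟧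

    filter-merge : ∀ {f U} → J [ type f ++ U ] ∘ [ f × U ] ∼ id

    filter-comm : ∀ {f g T U W}
                    {π : E.Perm T (type f ++ U)} {ρ : E.Perm T (type g ++ W)} →
                  (filterAt g ρ ⊕ filterAt g ρ) ∘ filterAt f π ∼
                  (id {[ T ]} ⊕ σ [ T ] [ T ] ⊕ id {[ T ]})
                    ∘ (filterAt f π ⊕ filterAt f π) ∘ filterAt g ρ

    filter-disjoint : ∀ {f U W} {h : E.Hom U W} →
                      (⟦ E.id {type f} E.× h ⟧ ⊕ ⟦ E.id {type f} E.× h ⟧) ∘ [ f × U ] ∼
                      [ f × W ] ∘ ⟦ E.id {type f} E.× h ⟧

    filter-copy : ∀ {f U} →
                  (⟦ copyFilterColumns f U ⟧ ⊕ ⟦ copyFilterColumns f U ⟧) ∘ [ f × U ] ∼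
                  [ f × (type f ++ U) ] ∘ ⟦ copyFilterColumns f U ⟧

    filter-preserveʳ : ∀ {f U} → let X = type f ++ U in
                       (id {[ X ]} ⊕ [ f × U ]) ∘ [ f × U ] ∼
                       (id {[ X ]} ⊕ E₀ [ X ] ⊕ id {[ X ]}) ∘ [ f × U ]
    filter-preserveˡ : ∀ {f U} → let X = type f ++ U in
                       ([ f × U ] ⊕ id {[ X ]}) ∘ [ f × U ] ∼
                       (id {[ X ]} ⊕ E₀ [ X ] ⊕ id {[ X ]}) ∘ [ f × U ]

  open Congruence _∼_ public

record Valuation {ℓ} (S : Signature ℓ) : Set (suc ℓ) where
  open Signature S
  field
    datatype  : Datatype → Set ℓ
    operation : ∀ o → All datatype (dom o) → All datatype (cod o)
    filter    : ∀ f → Pred (All datatype (type f)) ℓ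

module _ {ℓ} {S : Signature ℓ} (V : Valuation S) where
  open Signature S
  open Valuation V
  private
    module E = ℰ S
    module F = ℱ S

  ⟦_⟧ᴱ : E.Obj → Set ℓ
  ⟦ T ⟧ᴱ = All datatype T

  ⟦_⟧ᶠ : F.Obj → Set ℓ
  ⟦ A ⟧ᶠ = Any ⟦_⟧ᴱ A

  evalᴱ : ∀ {T U} → E.Hom T U → ⟦ T ⟧ᴱ → ⟦ U ⟧ᴱ
  evalᴱ (E.gen (E.op o))       x = operation o x
  evalᴱ (E.gen (E.copy T))     x = All.++⁺ x x
  evalᴱ (E.gen (E.discard T))  x = []
  evalᴱ E.id                   x = x
  evalᴱ (h E.∘ k)              x = evalᴱ h (evalᴱ k x)
  evalᴱ (E._×_ {A = T} h k)    x with All.++⁻ T x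
  ... | y , z = All.++⁺ (evalᴱ h y) (evalᴱ k z)
  evalᴱ (E.σ T U)              x with All.++⁻ T x
  ... | y , z = All.++⁺ z y

  -- Deciding membership in the subset V(f) is not constructive; excluded
  -- middle supplies the case distinction.
  module _ (em : ExcludedMiddle ℓ) where

    evalFilter : ∀ f U → ⟦ type f ++ U ⟧ᴱ → ⟦ (type f ++ U) ∷ (type f ++ U) ∷ [] ⟧ᶠ
    evalFilter f U x with em {filter f (proj₁ (All.++⁻ (type f) x))}
    ... | yes _ = here x
    ... | no  _ = there (here x)

    evalᶠ : ∀ {A B} → F.Hom A B → ⟦ A ⟧ᶠ → ⟦ B ⟧ᶠ
    evalᶠ (F.gen (F.arrow h))    (here x) = here (evalᴱ h x)
    evalᶠ (F.gen (F.filter f U)) (here x) = evalFilter f U x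
    evalᶠ (F.gen (F.merge A))    x = Sum.reduce (Any.++⁻ A x)
    evalᶠ (F.gen (F.empty A))    ()
    evalᶠ F.id                   x = x
    evalᶠ (d F.∘ e)              x = evalᶠ d (evalᶠ e x)
    evalᶠ (F._⊕_ {A = A} {B = B} d e) x =
      [ Any.++⁺ˡ ∘′ evalᶠ d , Any.++⁺ʳ B ∘′ evalᶠ e ]′ (Any.++⁻ A x)
    evalᶠ (F.σ A B)              x =
      [ Any.++⁺ʳ B , Any.++⁺ˡ ]′ (Any.++⁻ A x)

{-# OPTIONS --safe #-}

-- Soundness is a check of the axioms.  For completeness, ℰ has a term
-- model with propositional equality: in context T a datatype denotes the
-- set of terms over the columns of T, and every morphism h of ℰ is
-- recovered from the value of h at the tuple of variables.  In ℱ, splitting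
-- [ T ] by the condition f(t), for a tuple t of terms, is a derived morphism
-- `test f t`; copying the tested tuple in front of the row turns the axioms
-- on filters into merging, commutation and absorption laws for the
-- conditional `choose f t m n`.  Hence every morphism out of [ T ] is a
-- decision tree with tests (f , t) and rows of terms at its leaves.
-- Valuations on the term model can make any set of tests succeed, and by the
-- laws of the conditional two trees that reach the same leaf for each such
-- choice are equal.

module Submission where

open import Defs
open import Axiom.ExcludedMiddle using (ExcludedMiddle)
open import Data.Bool.Base using (Bool; true; false; if_then_else_)
open import Data.List.Base using (List; []; _∷_; [_]; _++_)
open import Data.List.Membership.Propositional using (_∈_)
open import Data.List.Properties using (++-assoc; ++-identityʳ)
open import Data.List.Relation.Unary.All as All using (All; []; _∷_)
import Data.List.Relation.Unary.All.Properties as All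
open import Data.List.Relation.Unary.Any using (Any; here; there)
import Data.List.Relation.Unary.Any.Properties as Any
open import Data.Nat.Base using (ℕ; suc; _+_; _<_; _≤_; z≤n; s≤s; s≤s⁻¹)
open import Data.Nat.Properties
  using (≤-refl; ≤-trans; +-mono-≤; m≤n⇒m≤1+n; m≤n⇒m≤n+o; m≤n⇒m≤o+n)
open import Data.Product.Base using (Σ; ∃; _,_; proj₁; proj₂)
open import Data.Sum.Base as Sum using (inj₁; inj₂; [_,_]′)
open import Function.Bundles using (_⇔_; mk⇔; Inverse)
open import Level using (Level; _⊔_; Lift; lift)
open import Relation.Binary.Bundles using (Setoid)
open import Relation.Binary.PropositionalEquality
  using (_≡_; refl; sym; trans; cong; cong₂; subst)
import Relation.Binary.Reasoning.Setoid as SetoidReasoning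
open import Relation.Nullary.Decidable.Core using (does; yes; no)
open import Relation.Nullary.Negation.Core using (contradiction)
open import Relation.Unary using (Pred)

-- Strict symmetric monoidal categories

-- The axioms on filters speak of literal columns, whereas tests arising in a diagram concern
-- arbitrary terms and may share columns; moving each test to columns of its own removes this
-- mismatch. All valuations used for completeness share the sets of terms and differ only in their
-- filters. One tree per diagram, computed at the single row of variables, therefore accounts for
-- its values under all of them. Trees are compared without an ordering on tests or a normal form:
-- both are expanded at a test occurring at a root of one of them, and deleting that test makes
-- their total size fall. Excluded middle decides equality of tests here, as the signature is
-- arbitrary. A recurring technical obstacle is that `_++_` is associative and right unital only up
-- to coercions. Several arguments therefore work with empty or singleton lists, where the coercions
-- compute to identities.

module SMCProperties {a g r : Level} (X : Set a) (Gen : List X → List X → Set g)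
  (_∼_ : ∀ {A B : List X} → StrictSMC.Hom X Gen A B → StrictSMC.Hom X Gen A B → Set r)
  where

  open StrictSMC X Gen
  open Congruence _∼_

  homSetoid : ∀ {A B : List X} → Setoid (a ⊔ g) (a ⊔ g ⊔ r)
  homSetoid {A} {B} = record
    { Carrier       = Hom A B
    ; _≈_           = _≈_
    ; isEquivalence = record { refl = ≈-refl ; sym = ≈-sym ; trans = ≈-trans }
    }

  module HomReasoning {A B : List X} = SetoidReasoning (homSetoid {A} {B})
  open HomReasoning

  infixr 4 refl⟩∘⟨_
  infixl 5 _⟩∘⟨refl

  refl⟩∘⟨_ : ∀ {A B C} {f : Hom B C} {h h′ : Hom A B} → h ≈ h′ → f ∘ h ≈ f ∘ h′
  refl⟩∘⟨ p = ∘-cong ≈-refl p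

  _⟩∘⟨refl : ∀ {A B C} {f f′ : Hom B C} {h : Hom A B} → f ≈ f′ → f ∘ h ≈ f′ ∘ h
  p ⟩∘⟨refl = ∘-cong p ≈-refl

  pullˡ : ∀ {A B C D} {f : Hom C D} {h : Hom B C} {m : Hom B D} {k : Hom A B} →
          f ∘ h ≈ m → f ∘ h ∘ k ≈ m ∘ k
  pullˡ p = ≈-trans (≈-sym assoc) (p ⟩∘⟨refl)

  pushˡ : ∀ {A B C D} {f : Hom C D} {h : Hom B C} {m : Hom B D} {k : Hom A B} →
          m ≈ f ∘ h → m ∘ k ≈ f ∘ h ∘ k
  pushˡ p = ≈-sym (pullˡ (≈-sym p))

  extendʳ : ∀ {A B B′ C D} {f : Hom C D} {h : Hom B C} {f′ : Hom B′ D} {h′ : Hom B B′}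
            {k : Hom A B} → f ∘ h ≈ f′ ∘ h′ → f ∘ h ∘ k ≈ f′ ∘ h′ ∘ k
  extendʳ p = ≈-trans (pullˡ p) assoc

  cancelˡ : ∀ {A B C} {f : Hom B C} {h : Hom C B} {k : Hom A C} →
            f ∘ h ≈ id → f ∘ h ∘ k ≈ k
  cancelˡ p = ≈-trans (pullˡ p) identityˡ

  elimʳ : ∀ {A B} {f : Hom A B} {h : Hom A A} → h ≈ id → f ∘ h ≈ f
  elimʳ p = ≈-trans (refl⟩∘⟨ p) identityʳ

  -- Associativity and unit laws carry coercions on both sides. Where these compute to `id`, this
  -- strips them.
  unframe : ∀ {A B} {f h : Hom A B} → id ∘ f ≈ h ∘ id → f ≈ h
  unframe p = ≈-trans (≈-sym identityˡ) (≈-trans p identityʳ)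

  ⊗-merge : ∀ {A B C A′ B′ C′} {f : Hom B C} {h : Hom A B} {m : Hom A C}
            {f′ : Hom B′ C′} {h′ : Hom A′ B′} {m′ : Hom A′ C′} →
            f ∘ h ≈ m → f′ ∘ h′ ≈ m′ → (f ⊗ f′) ∘ (h ⊗ h′) ≈ m ⊗ m′
  ⊗-merge p q = ≈-trans (≈-sym ⊗-∘) (⊗-cong p q)

  square-∘ : ∀ {A B C A′ B′ C′} {u : Hom B B′} {v : Hom A A′} {u′ : Hom C C′}
             {f : Hom A B} {f′ : Hom A′ B′} {h : Hom B C} {h′ : Hom B′ C′} →
             u′ ∘ h ≈ h′ ∘ u → u ∘ f ≈ f′ ∘ v → u′ ∘ (h ∘ f) ≈ (h′ ∘ f′) ∘ v
  square-∘ p q = ≈-trans (extendʳ p) (≈-trans (refl⟩∘⟨ q) (≈-sym assoc))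

  square-⊗ : ∀ {A B A′ B′ C D C′ D′} {f : Hom A B} {f′ : Hom A′ B′} {u : Hom B B′} {v : Hom A A′}
             {h : Hom C D} {h′ : Hom C′ D′} {w : Hom D D′} {z : Hom C C′} →
             u ∘ f ≈ f′ ∘ v → w ∘ h ≈ h′ ∘ z → (u ⊗ w) ∘ (f ⊗ h) ≈ (f′ ⊗ h′) ∘ (v ⊗ z)
  square-⊗ p q = ≈-trans (⊗-merge p q) ⊗-∘

  square-id : ∀ {A B} {f : Hom A B} → f ∘ id ≈ id ∘ f
  square-id = ≈-trans identityʳ (≈-sym identityˡ)

  coe-sym : ∀ {A B} (p : A ≡ B) → coe (sym p) ∘ coe p ≈ id
  coe-sym refl = identityˡ

  sym-coe : ∀ {A B} (p : A ≡ B) → coe p ∘ coe (sym p) ≈ id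
  sym-coe refl = identityˡ

  α⁻¹-natural : ∀ {A B C A′ B′ C′} {f : Hom A A′} {h : Hom B B′} {k : Hom C C′} →
                ((f ⊗ h) ⊗ k) ∘ α⁻¹ A B C ≈ α⁻¹ A′ B′ C′ ∘ (f ⊗ (h ⊗ k))
  α⁻¹-natural {A} {B} {C} {A′} {B′} {C′} {f} {h} {k} = begin
    ((f ⊗ h) ⊗ k) ∘ α⁻¹ A B C
      ≈⟨ cancelˡ (coe-sym _) ⟨
    α⁻¹ A′ B′ C′ ∘ α A′ B′ C′ ∘ ((f ⊗ h) ⊗ k) ∘ α⁻¹ A B C
      ≈⟨ refl⟩∘⟨ extendʳ ⊗-assoc ⟩
    α⁻¹ A′ B′ C′ ∘ (f ⊗ (h ⊗ k)) ∘ α A B C ∘ α⁻¹ A B C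
      ≈⟨ refl⟩∘⟨ elimʳ (sym-coe _) ⟩
    α⁻¹ A′ B′ C′ ∘ (f ⊗ (h ⊗ k)) ∎

  interchange-natural : ∀ {A B C D A′ B′ C′ D′}
    {f : Hom A A′} {h : Hom B B′} {k : Hom C C′} {l : Hom D D′} →
    interchange A′ B′ C′ D′ ∘ ((f ⊗ h) ⊗ (k ⊗ l)) ≈
    ((f ⊗ k) ⊗ (h ⊗ l)) ∘ interchange A B C D
  interchange-natural = ≈-sym
    (square-∘ α⁻¹-natural
      (square-∘
        (square-⊗ square-id
          (square-∘ (≈-sym ⊗-assoc)
            (square-∘ (square-⊗ (≈-sym σ-natural) square-id) α⁻¹-natural)))
        (≈-sym ⊗-assoc)))

  -- The two objects exchanged are empty, so the middle symmetry is `ρ []`, and at these lists every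
  -- coercion computes to `id`.
  interchange-singleton : ∀ {s U} → interchange [ s ] [] [] U ≈ id
  interchange-singleton = ≈-trans identityˡ (≈-trans identityʳ
    (≈-trans (⊗-cong ≈-refl (≈-trans identityˡ (≈-trans identityʳ
      (≈-trans (⊗-cong σ-unit ≈-refl) ⊗-id)))) ⊗-id))

  σ-[]ˡ : ∀ {A} → σ [] A ∘ ρ A ≈ id
  σ-[]ˡ = ≈-trans (refl⟩∘⟨ ≈-sym σ-unit) σ-involutive

  ⁻¹ₚ-inverseˡ : ∀ {A B} (π : Perm A B) → ⌊ π ⁻¹ₚ ⌋ ∘ ⌊ π ⌋ ≈ id
  ⁻¹ₚ-inverseˡ idₚ      = identityˡ
  ⁻¹ₚ-inverseˡ (π ∘ₚ ρ) =
    ≈-trans assoc (≈-trans (refl⟩∘⟨ cancelˡ (⁻¹ₚ-inverseˡ π)) (⁻¹ₚ-inverseˡ ρ))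
  ⁻¹ₚ-inverseˡ (π ⊗ₚ ρ) = ≈-trans (⊗-merge (⁻¹ₚ-inverseˡ π) (⁻¹ₚ-inverseˡ ρ)) ⊗-id
  ⁻¹ₚ-inverseˡ (σₚ A B) = σ-involutive

  -- A permutation built across brackets needs reassociation, which `Perm` offers only as `idₚ`
  -- along an equality of objects.
  coeₚ : ∀ {A B} → A ≡ B → Perm A B
  coeₚ refl = idₚ

  ⌊coeₚ⌋ : ∀ {A B} (p : A ≡ B) → ⌊ coeₚ p ⌋ ≡ coe p
  ⌊coeₚ⌋ refl = refl

-- The cartesian category ℰ

module ℰProperties {ℓ : Level} (S : Signature ℓ) where
  open Signature S
  open ℰ S
  open SMCProperties Datatype Gen _∼_ public
  open HomReasoning

  ⟨_,_⟩ : ∀ {T U W} → Hom T U → Hom T W → Hom T (U ++ W)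
  ⟨ h , k ⟩ = (h × k) ∘ δ _

  π₂ : ∀ T U → Hom (T ++ U) U
  π₂ T U = ⊥ T × id {U}

  ⟨⟩-cong : ∀ {T U W} {h h′ : Hom T U} {k k′ : Hom T W} → h ≈ h′ → k ≈ k′ → ⟨ h , k ⟩ ≈ ⟨ h′ , k′ ⟩
  ⟨⟩-cong p q = ⊗-cong p q ⟩∘⟨refl

  ⟨⟩-∘ : ∀ {R T U W} {h : Hom T U} {k : Hom T W} {m : Hom R T} → ⟨ h , k ⟩ ∘ m ≈ ⟨ h ∘ m , k ∘ m ⟩
  ⟨⟩-∘ {h = h} {k} {m} = begin
    ((h × k) ∘ δ _) ∘ m        ≈⟨ assoc ⟩
    (h × k) ∘ δ _ ∘ m          ≈⟨ refl⟩∘⟨ axiom δ-natural ⟩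
    (h × k) ∘ (m × m) ∘ δ _    ≈⟨ pullˡ (≈-sym ⊗-∘) ⟩
    ((h ∘ m) × (k ∘ m)) ∘ δ _      ∎

  ×-∘-⟨⟩ : ∀ {T U W U′ W′} {h : Hom T U} {k : Hom T W} {m : Hom U U′} {n : Hom W W′} →
           (m × n) ∘ ⟨ h , k ⟩ ≈ ⟨ m ∘ h , n ∘ k ⟩
  ×-∘-⟨⟩ = pullˡ (≈-sym ⊗-∘)

  ⟨⊥,⟩ : ∀ {T U} {k : Hom T U} → ⟨ ⊥ T , k ⟩ ≈ k
  ⟨⊥,⟩ {T} {k = k} = begin
    (⊥ T × k) ∘ δ T                    ≈⟨ ⊗-cong identityˡ identityʳ ⟩∘⟨refl ⟨
    ((id {[]} ∘ ⊥ T) × (k ∘ id)) ∘ δ T     ≈⟨ pushˡ ⊗-∘ ⟩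
    (id {[]} × k) ∘ (⊥ T × id) ∘ δ T   ≈⟨ elimʳ (axiom δ-unitˡ) ⟩
    id {[]} × k                        ≈⟨ ⊗-unitˡ ⟩
    k                                  ∎

  π₂-⟨⟩ : ∀ {T U W} {h : Hom T U} {k : Hom T W} → π₂ U W ∘ ⟨ h , k ⟩ ≈ k
  π₂-⟨⟩ {T} {U} {W} {h} {k} = begin
    π₂ U W ∘ ⟨ h , k ⟩    ≈⟨ ×-∘-⟨⟩ ⟩
    ⟨ ⊥ U ∘ h , id ∘ k ⟩  ≈⟨ ⟨⟩-cong (axiom ⊥-natural) identityˡ ⟩
    ⟨ ⊥ T , k ⟩           ≈⟨ ⟨⊥,⟩ ⟩
    k                     ∎

  ⟨⟩-assoc : ∀ {T U W Y} {h : Hom T U} {k : Hom T W} {l : Hom T Y} →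
             α U W Y ∘ ⟨ ⟨ h , k ⟩ , l ⟩ ≈ ⟨ h , ⟨ k , l ⟩ ⟩
  ⟨⟩-assoc {T} {U} {W} {Y} {h} {k} {l} = begin
    α U W Y ∘ ⟨ ⟨ h , k ⟩ , l ⟩
      ≈⟨ refl⟩∘⟨ ⟨⟩-cong ≈-refl identityʳ ⟨
    α U W Y ∘ ⟨ (h × k) ∘ δ T , l ∘ id ⟩
      ≈⟨ refl⟩∘⟨ ×-∘-⟨⟩ ⟨
    α U W Y ∘ ((h × k) × l) ∘ ⟨ δ T , id ⟩
      ≈⟨ extendʳ ⊗-assoc ⟩
    (h × (k × l)) ∘ α T T T ∘ ⟨ δ T , id ⟩
      ≈⟨ refl⟩∘⟨ axiom δ-assoc ⟩
    (h × (k × l)) ∘ ⟨ id , δ T ⟩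
      ≈⟨ ×-∘-⟨⟩ ⟩
    ⟨ h ∘ id , ⟨ k , l ⟩ ⟩
      ≈⟨ ⟨⟩-cong identityʳ ≈-refl ⟩
    ⟨ h , ⟨ k , l ⟩ ⟩ ∎

  ⟨⟩-assoc⁻¹ : ∀ {T U W Y} {h : Hom T U} {k : Hom T W} {l : Hom T Y} →
             α⁻¹ U W Y ∘ ⟨ h , ⟨ k , l ⟩ ⟩ ≈ ⟨ ⟨ h , k ⟩ , l ⟩
  ⟨⟩-assoc⁻¹ = ≈-trans (refl⟩∘⟨ ≈-sym ⟨⟩-assoc) (cancelˡ (coe-sym _))

  σ-⟨⟩ : ∀ {T U W} {h : Hom T U} {k : Hom T W} → σ U W ∘ ⟨ h , k ⟩ ≈ ⟨ k , h ⟩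
  σ-⟨⟩ {T} {U} {W} {h} {k} = begin
    σ U W ∘ (h × k) ∘ δ T  ≈⟨ extendʳ σ-natural ⟩
    (k × h) ∘ σ T T ∘ δ T  ≈⟨ refl⟩∘⟨ axiom δ-comm ⟩
    (k × h) ∘ δ T          ∎

  -- The object is split at a singleton because there every associator
  -- occurring in the interchange is an identity by computation.
  ⟨⟩-η : ∀ {s U} → ⟨ id {[ s ]} × ⊥ U , π₂ [ s ] U ⟩ ≈ id {s ∷ U}
  ⟨⟩-η {s} {U} = begin
    ((id {[ s ]} × ⊥ U) × π₂ [ s ] U) ∘ δ ([ s ] ++ U)
      ≈⟨ refl⟩∘⟨ axiom (δ-× {[ s ]} {U}) ⟩
    ((id {[ s ]} × ⊥ U) × π₂ [ s ] U) ∘ interchange [ s ] [ s ] U U ∘ (δ [ s ] × δ U)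
      ≈⟨ extendʳ (≈-sym (interchange-natural {A = [ s ]} {[ s ]} {U} {U} {[ s ]} {[]} {[]} {U})) ⟩
    interchange [ s ] [] [] U ∘ ((id {[ s ]} × ⊥ [ s ]) × (⊥ U × id {U})) ∘ (δ [ s ] × δ U)
      ≈⟨ interchange-singleton ⟩∘⟨refl ⟩
    id ∘ ((id {[ s ]} × ⊥ [ s ]) × (⊥ U × id {U})) ∘ (δ [ s ] × δ U)
      ≈⟨ identityˡ ⟩
    ((id {[ s ]} × ⊥ [ s ]) × (⊥ U × id {U})) ∘ (δ [ s ] × δ U)
      ≈⟨ ⊗-merge (≈-trans (≈-sym identityˡ) (axiom δ-unitʳ)) (axiom δ-unitˡ) ⟩
    id {[ s ]} × id {U}
      ≈⟨ ⊗-id ⟩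
    id ∎

  projection : ∀ {s T} → s ∈ T → Hom T [ s ]
  projection {T = s ∷ T} (here refl) = id {[ s ]} × ⊥ T
  projection {T = s ∷ T} (there i)   = ⊥ [ s ] × projection i

  projection-there : ∀ {s t T} (i : s ∈ T) → projection (there {x = t} i) ≈ projection i ∘ π₂ [ t ] T
  projection-there {s} {t} {T} i = begin
    ⊥ [ t ] × projection i                         ≈⟨ ⊗-cong identityˡ identityʳ ⟨
    (id {[]} ∘ ⊥ [ t ]) × (projection i ∘ id)        ≈⟨ ⊗-∘ ⟩
    (id {[]} × projection i) ∘ (⊥ [ t ] × id {T})  ≈⟨ ⊗-unitˡ ⟩∘⟨refl ⟩
    projection i ∘ π₂ [ t ] T                      ∎

-- An operation with several outputs contributes one term for each output,
-- so that tuples of terms represent morphisms of ℰ without a quotient.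

module Terms {ℓ : Level} (S : Signature ℓ) (T : ℰ.Obj S) where
  open Signature S
  open ℰ S
  open ℰProperties S
  open HomReasoning

  data Term : Datatype → Set ℓ where
    var : ∀ {s} → s ∈ T → Term s
    app : ∀ {s} o → All Term (dom o) → s ∈ cod o → Term s

  Terms : Obj → Set ℓ
  Terms = All Term

  -- Filters remain a parameter because completeness varies them alone.
  model : (∀ f → Pred (Terms (type f)) ℓ) → Valuation S
  model P = record
    { datatype  = Term
    ; operation = λ o x → All.tabulate (app o x)
    ; filter    = P
    }

  reify : ∀ {s} → Term s → Hom T [ s ]
  ⌜_⌝ : ∀ {U} → Terms U → Hom T U

  reify (var i)     = projection i
  reify (app o x i) = projection i ∘ gen (op o) ∘ ⌜ x ⌝

  ⌜ [] ⌝    = ⊥ T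
  ⌜ t ∷ x ⌝ = ⟨ reify t , ⌜ x ⌝ ⟩

  ⌜++⌝ : ∀ {U W} (x : Terms U) (y : Terms W) → ⌜ All.++⁺ x y ⌝ ≈ ⟨ ⌜ x ⌝ , ⌜ y ⌝ ⟩
  ⌜++⌝ []      y = ≈-sym ⟨⊥,⟩
  ⌜++⌝ (t ∷ x) y = ≈-trans (⟨⟩-cong ≈-refl (⌜++⌝ x y)) (≈-trans (≈-sym ⟨⟩-assoc) identityˡ)

  ⌜⌝-split : ∀ U {W} (x : Terms (U ++ W)) →
             ⌜ x ⌝ ≈ ⟨ ⌜ proj₁ (All.++⁻ U x) ⌝ , ⌜ proj₂ (All.++⁻ U x) ⌝ ⟩
  ⌜⌝-split U x =
    subst (λ y → ⌜ y ⌝ ≈ ⟨ ⌜ proj₁ (All.++⁻ U x) ⌝ , ⌜ proj₂ (All.++⁻ U x) ⌝ ⟩)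
      (Inverse.strictlyInverseˡ (All.++↔ {xs = U}) x)
      (⌜++⌝ (proj₁ (All.++⁻ U x)) (proj₂ (All.++⁻ U x)))

  -- The projections out of `U` are jointly monic: `⟨⟩-η` peels off one column at a time, and the
  -- empty product is terminal. This is what makes an operation with several outputs equal to the
  -- tuple of its separate outputs.
  ⌜tabulate⌝ : ∀ {U} (h : Hom T U) (t : ∀ {s} → s ∈ U → Term s) →
               (∀ {s} (i : s ∈ U) → reify (t i) ≈ projection i ∘ h) →
               ⌜ All.tabulate t ⌝ ≈ h
  ⌜tabulate⌝ {[]} h t p = begin
    ⊥ T       ≈⟨ axiom ⊥-natural ⟨
    ⊥ [] ∘ h  ≈⟨ axiom ⊥-unit ⟩∘⟨refl ⟩
    id ∘ h    ≈⟨ identityˡ ⟩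
    h         ∎
  ⌜tabulate⌝ {s ∷ U} h t p = begin
    ⟨ reify (t (here refl)) , ⌜ All.tabulate (λ i → t (there i)) ⌝ ⟩
      ≈⟨ ⟨⟩-cong (p (here refl)) (⌜tabulate⌝ (π₂ [ s ] U ∘ h) (λ i → t (there i))
           (λ i → ≈-trans (p (there i)) (≈-trans (projection-there i ⟩∘⟨refl) assoc))) ⟩
    ⟨ (id {[ s ]} × ⊥ U) ∘ h , π₂ [ s ] U ∘ h ⟩
      ≈⟨ ⟨⟩-∘ ⟨
    ⟨ id {[ s ]} × ⊥ U , π₂ [ s ] U ⟩ ∘ h
      ≈⟨ ⟨⟩-η ⟩∘⟨refl ⟩
    id ∘ h
      ≈⟨ identityˡ ⟩
    h ∎

  ⌜variables⌝ : ⌜ All.tabulate var ⌝ ≈ id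
  ⌜variables⌝ = ⌜tabulate⌝ id var (λ i → ≈-sym identityʳ)

  module _ (P : ∀ f → Pred (Terms (type f)) ℓ) where

    ⌜evalᴱ⌝ : ∀ {U W} (h : Hom U W) (x : Terms U) → h ∘ ⌜ x ⌝ ≈ ⌜ evalᴱ (model P) h x ⌝
    ⌜evalᴱ⌝ (gen (op o)) x      = ≈-sym (⌜tabulate⌝ _ (app o x) (λ i → ≈-refl))
    ⌜evalᴱ⌝ (gen (copy U)) x    = ≈-trans (axiom δ-natural) (≈-sym (⌜++⌝ x x))
    ⌜evalᴱ⌝ (gen (discard U)) x = axiom ⊥-natural
    ⌜evalᴱ⌝ id x                = identityˡ
    ⌜evalᴱ⌝ (h ∘ k) x           =
      ≈-trans assoc (≈-trans (refl⟩∘⟨ ⌜evalᴱ⌝ k x) (⌜evalᴱ⌝ h _))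
    -- The read-back of the split is abstracted along with the split, because `evalᴱ` itself
    -- branches on `All.++⁻ U x`.
    ⌜evalᴱ⌝ (_×_ {A = U} h k) x with All.++⁻ U x | ⌜⌝-split U x
    ... | y , z | p = begin
      (h × k) ∘ ⌜ x ⌝              ≈⟨ refl⟩∘⟨ p ⟩
      (h × k) ∘ ⟨ ⌜ y ⌝ , ⌜ z ⌝ ⟩    ≈⟨ ×-∘-⟨⟩ ⟩
      ⟨ h ∘ ⌜ y ⌝ , k ∘ ⌜ z ⌝ ⟩      ≈⟨ ⟨⟩-cong (⌜evalᴱ⌝ h y) (⌜evalᴱ⌝ k z) ⟩
      ⟨ ⌜ _ ⌝ , ⌜ _ ⌝ ⟩             ≈⟨ ⌜++⌝ _ _ ⟨
      ⌜ All.++⁺ (evalᴱ (model P) h y) (evalᴱ (model P) k z) ⌝ ∎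
    ⌜evalᴱ⌝ (σ U W) x with All.++⁻ U x | ⌜⌝-split U x
    ... | y , z | p = ≈-trans (refl⟩∘⟨ p) (≈-trans σ-⟨⟩ (≈-sym (⌜++⌝ z y)))

-- Lets a tree be computed at one fixed choice of filters and still describe evaluation at every
-- other choice.
evalᴱ-filter-irrelevant :
  ∀ {ℓ} {S : Signature ℓ} {D O} P Q {T U} (h : ℰ.Hom S T U) (x : All D T) →
  evalᴱ (record { datatype = D ; operation = O ; filter = P }) h x ≡
  evalᴱ (record { datatype = D ; operation = O ; filter = Q }) h x
evalᴱ-filter-irrelevant P Q (ℰ.gen (ℰ.op o)) x      = refl
evalᴱ-filter-irrelevant P Q (ℰ.gen (ℰ.copy T)) x    = refl
evalᴱ-filter-irrelevant P Q (ℰ.gen (ℰ.discard T)) x = refl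
evalᴱ-filter-irrelevant P Q ℰ.id x                  = refl
evalᴱ-filter-irrelevant P Q (h ℰ.∘ k) x             =
  trans (evalᴱ-filter-irrelevant P Q h _) (cong (evalᴱ _ h) (evalᴱ-filter-irrelevant P Q k x))
evalᴱ-filter-irrelevant P Q (ℰ._×_ {A = T} h k) x with All.++⁻ T x
... | y , z = cong₂ All.++⁺ (evalᴱ-filter-irrelevant P Q h y) (evalᴱ-filter-irrelevant P Q k z)
evalᴱ-filter-irrelevant P Q (ℰ.σ T U) x             = refl

-- Conditionals in ℱ

module ℱProperties {ℓ : Level} (S : Signature ℓ) where
  open Signature S
  open ℱ S
  private
    module E where
      open ℰ S public
      open ℰProperties S public
  open SMCProperties E.Obj Gen _∼_ public
  open HomReasoning

  arrow-square : ∀ {T U U′ W} {h : E.Hom U W} {k : E.Hom T U} {h′ : E.Hom U′ W} {k′ : E.Hom T U′} →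
                 h E.∘ k E.≈ h′ E.∘ k′ → ⟦ h ⟧ ∘ ⟦ k ⟧ ≈ ⟦ h′ ⟧ ∘ ⟦ k′ ⟧
  arrow-square p =
    ≈-trans (axiom arrow-∘) (≈-trans (axiom (arrow-cong p)) (≈-sym (axiom arrow-∘)))

  arrow-merge : ∀ {T U W} {h : E.Hom U W} {k : E.Hom T U} {m : E.Hom T W} →
                h E.∘ k E.≈ m → ⟦ h ⟧ ∘ ⟦ k ⟧ ≈ ⟦ m ⟧
  arrow-merge p = ≈-trans (axiom arrow-∘) (axiom (arrow-cong p))

  arrow-inverse : ∀ {T U} {h : E.Hom U T} {k : E.Hom T U} → h E.∘ k E.≈ E.id → ⟦ h ⟧ ∘ ⟦ k ⟧ ≈ id
  arrow-inverse p = ≈-trans (arrow-merge p) (axiom arrow-id)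

  E-[] : ∀ {A B} (d : Hom A B) → d ⊕ E₀ [] ≈ d ⊕ id {[]}
  E-[] d = ⊗-cong ≈-refl (axiom E-unit)

  ⊕-E-[] : ∀ {T U} (d : Hom [ T ] [ U ]) → d ⊕ E₀ [] ≈ d
  ⊕-E-[] d = ≈-trans (E-[] d) (unframe ⊗-unitʳ)

  J-E⊕ : ∀ {A B} (d : Hom A B) → J B ∘ (E₀ B ⊕ d) ≈ d
  J-E⊕ {A} {B} d = begin
    J B ∘ (E₀ B ⊕ d)                     ≈⟨ refl⟩∘⟨ ⊗-cong identityʳ identityˡ ⟨
    J B ∘ ((E₀ B ∘ id) ⊕ (id ∘ d))       ≈⟨ refl⟩∘⟨ ⊗-∘ ⟩
    J B ∘ (E₀ B ⊕ id) ∘ (id {[]} ⊕ d)    ≈⟨ cancelˡ (axiom J-unitˡ) ⟩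
    id {[]} ⊕ d                          ≈⟨ ⊗-unitˡ ⟩
    d ∎

  J-⊕E : ∀ {T B} (d : Hom [ T ] B) → J B ∘ (d ⊕ E₀ B) ≈ d
  J-⊕E {T} {B} d = begin
    J B ∘ (d ⊕ E₀ B)                     ≈⟨ refl⟩∘⟨ ⊗-cong identityˡ identityʳ ⟨
    J B ∘ ((id ∘ d) ⊕ (E₀ B ∘ id))       ≈⟨ refl⟩∘⟨ ⊗-∘ ⟩
    J B ∘ (id ⊕ E₀ B) ∘ (d ⊕ id {[]})    ≈⟨ pullˡ (axiom J-unitʳ) ⟩
    ρ B ∘ (d ⊕ id {[]})                  ≈⟨ ⊗-unitʳ ⟩
    d ∘ id                               ≈⟨ identityʳ ⟩
    d ∎

  -- In a coproduct this is the copairing of two injected morphisms. Through it the two outputs of a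
  -- filter become the two branches of one conditional.
  J-⊕E-E⊕ : ∀ {T U A B} (d : Hom [ T ] A) (e : Hom [ U ] B) →
            J (A ++ B) ∘ ((d ⊕ E₀ B) ⊕ (E₀ A ⊕ e)) ≈ d ⊕ e
  J-⊕E-E⊕ {T} {U} {A} {B} d e = begin
    J (A ++ B) ∘ ((d ⊕ E₀ B) ⊕ (E₀ A ⊕ e))
      ≈⟨ pushˡ (axiom J-⊕) ⟩
    (J A ⊕ J B) ∘ interchange A B A B ∘ ((d ⊕ E₀ B) ⊕ (E₀ A ⊕ e))
      ≈⟨ refl⟩∘⟨ interchange-natural {A = [ T ]} {[]} {[]} {[ U ]} ⟩
    (J A ⊕ J B) ∘ ((d ⊕ E₀ A) ⊕ (E₀ B ⊕ e)) ∘ interchange [ T ] [] [] [ U ]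
      ≈⟨ refl⟩∘⟨ elimʳ interchange-singleton ⟩
    (J A ⊕ J B) ∘ ((d ⊕ E₀ A) ⊕ (E₀ B ⊕ e))
      ≈⟨ ⊗-merge (J-⊕E d) (J-E⊕ e) ⟩
    d ⊕ e ∎

  J-∘-⊕ : ∀ {A B} (d : Hom A B) → J B ∘ (d ⊕ d) ≈ d ∘ J A
  J-∘-⊕ d = ≈-sym (axiom J-natural)


  -- Testing a tuple of terms

  module _ (f : Filter) where

    private
      F : E.Obj
      F = type f

    test : ∀ {T} → E.Hom T F → Hom [ T ] (T ∷ T ∷ [])
    test {T} t = (⟦ E.π₂ F T ⟧ ⊕ ⟦ E.π₂ F T ⟧) ∘ [ f × T ] ∘ ⟦ E.⟨ t , E.id ⟩ ⟧

    -- Copying the tested columns and then forgetting the copy is the identity. By `filter-copy` the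
    -- filter may act on the copy, which leaves the original columns as inert data; by
    -- `filter-disjoint` the row `⟨ t , u ⟩` can then be built after the filter instead of before.
    -- The switch between the two axioms is `c∘x`, whose sides both equal `⟨ t , ⟨ t , u ⟩ ⟩`.
    filter-⟨⟩ : ∀ {T U} (t : E.Hom T F) (u : E.Hom T U) →
                [ f × U ] ∘ ⟦ E.⟨ t , u ⟩ ⟧ ≈ (⟦ E.⟨ t , u ⟩ ⟧ ⊕ ⟦ E.⟨ t , u ⟩ ⟧) ∘ test t
    filter-⟨⟩ {T} {U} t u = begin
      [ f × U ] ∘ ⟦ x ⟧
        ≈⟨ ≈-trans (⊗-cong π-copy π-copy ⟩∘⟨refl) (≈-trans (⊗-id ⟩∘⟨refl) identityˡ) ⟨
      ((⟦ π ⟧ ∘ ⟦ c ⟧) ⊕ (⟦ π ⟧ ∘ ⟦ c ⟧)) ∘ [ f × U ] ∘ ⟦ x ⟧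
        ≈⟨ pushˡ ⊗-∘ ⟩
      (⟦ π ⟧ ⊕ ⟦ π ⟧) ∘ (⟦ c ⟧ ⊕ ⟦ c ⟧) ∘ [ f × U ] ∘ ⟦ x ⟧
        ≈⟨ refl⟩∘⟨ extendʳ (axiom filter-copy) ⟩
      (⟦ π ⟧ ⊕ ⟦ π ⟧) ∘ [ f × X ] ∘ ⟦ c ⟧ ∘ ⟦ x ⟧
        ≈⟨ refl⟩∘⟨ refl⟩∘⟨ arrow-square c∘x ⟩
      (⟦ π ⟧ ⊕ ⟦ π ⟧) ∘ [ f × X ] ∘ ⟦ E.id {F} E.× x ⟧ ∘ ⟦ k ⟧
        ≈⟨ refl⟩∘⟨ extendʳ (axiom filter-disjoint) ⟨
      (⟦ π ⟧ ⊕ ⟦ π ⟧) ∘ (⟦ E.id E.× x ⟧ ⊕ ⟦ E.id E.× x ⟧) ∘ [ f × T ] ∘ ⟦ k ⟧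
        ≈⟨ extendʳ (square-⊗ (arrow-square π-×) (arrow-square π-×)) ⟩
      (⟦ x ⟧ ⊕ ⟦ x ⟧) ∘ test t ∎
      where
      X : E.Obj
      X = F ++ U

      x : E.Hom T X
      x = E.⟨ t , u ⟩

      π : E.Hom (F ++ X) X
      π = E.π₂ F X

      c : E.Hom X (F ++ X)
      c = copyFilterColumns f U

      k : E.Hom T (F ++ T)
      k = E.⟨ t , E.id ⟩

      c∘x : c E.∘ x E.≈ (E.id {F} E.× x) E.∘ k
      c∘x = EP.begin
        c E.∘ x
          EP.≈⟨ E.assoc ⟩
        E.α F F U E.∘ (E.δ F E.× E.id) E.∘ x
          EP.≈⟨ E.refl⟩∘⟨ E.×-∘-⟨⟩ ⟩
        E.α F F U E.∘ E.⟨ E.δ F E.∘ t , E.id E.∘ u ⟩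
          EP.≈⟨ E.refl⟩∘⟨ E.⟨⟩-cong (E.axiom E.δ-natural) E.identityˡ ⟩
        E.α F F U E.∘ E.⟨ E.⟨ t , t ⟩ , u ⟩
          EP.≈⟨ E.⟨⟩-assoc ⟩
        E.⟨ t , x ⟩
          EP.≈⟨ E.⟨⟩-cong E.identityˡ E.identityʳ ⟨
        E.⟨ E.id E.∘ t , x E.∘ E.id ⟩
          EP.≈⟨ E.×-∘-⟨⟩ ⟨
        (E.id {F} E.× x) E.∘ k EP.∎
        where module EP = E.HomReasoning

      π-× : ∀ {W} {m : E.Hom T W} → E.π₂ F W E.∘ (E.id {F} E.× m) E.≈ m E.∘ E.π₂ F T
      π-× {W} {m} = EP.begin
        E.π₂ F W E.∘ (E.id {F} E.× m)
          EP.≈⟨ E.⊗-merge E.identityʳ E.identityˡ ⟩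
        E.⊥ F E.× m
          EP.≈⟨ E.⊗-merge E.identityˡ E.identityʳ ⟨
        (E.id {[]} E.× m) E.∘ E.π₂ F T
          EP.≈⟨ E.⊗-unitˡ E.⟩∘⟨refl ⟩
        m E.∘ E.π₂ F T EP.∎
        where module EP = E.HomReasoning

      π-c : π E.∘ c E.≈ E.id
      π-c = EP.begin
        E.π₂ F X E.∘ E.α F F U E.∘ (E.δ F E.× E.id)
          EP.≈⟨ E.⊗-cong E.≈-refl E.⊗-id E.⟩∘⟨refl ⟨
        (E.⊥ F E.× (E.id {F} E.× E.id {U})) E.∘ E.α F F U E.∘ (E.δ F E.× E.id)
          EP.≈⟨ E.extendʳ (E.≈-sym E.⊗-assoc) ⟩
        E.id E.∘ ((E.⊥ F E.× E.id {F}) E.× E.id {U}) E.∘ (E.δ F E.× E.id)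
          EP.≈⟨ E.identityˡ ⟩
        ((E.⊥ F E.× E.id {F}) E.× E.id {U}) E.∘ (E.δ F E.× E.id)
          EP.≈⟨ E.⊗-merge (E.axiom E.δ-unitˡ) E.identityˡ ⟩
        E.id {F} E.× E.id {U}
          EP.≈⟨ E.⊗-id ⟩
        E.id EP.∎
        where module EP = E.HomReasoning

      π-copy : ⟦ π ⟧ ∘ ⟦ c ⟧ ≈ id
      π-copy = arrow-inverse π-c

    -- Only the terms `t` that `π` moves into the tested columns matter: after `filter-⟨⟩` the
    -- inverse permutation rebuilds `h` on either branch.
    filterAt-∘ : ∀ {R T U} (π : E.Perm R (F ++ U)) {h : E.Hom T R} {t : E.Hom T F} {u : E.Hom T U} →
                 E.⌊ π ⌋ E.∘ h E.≈ E.⟨ t , u ⟩ →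
                 filterAt f π ∘ ⟦ h ⟧ ≈ (⟦ h ⟧ ⊕ ⟦ h ⟧) ∘ test t
    filterAt-∘ {R} {T} {U} π {h} {t} {u} p = begin
      ((⟦ π⁻¹ ⟧ ⊕ ⟦ π⁻¹ ⟧) ∘ [ f × U ] ∘ ⟦ E.⌊ π ⌋ ⟧) ∘ ⟦ h ⟧
        ≈⟨ ≈-trans assoc (refl⟩∘⟨ assoc) ⟩
      (⟦ π⁻¹ ⟧ ⊕ ⟦ π⁻¹ ⟧) ∘ [ f × U ] ∘ ⟦ E.⌊ π ⌋ ⟧ ∘ ⟦ h ⟧
        ≈⟨ refl⟩∘⟨ refl⟩∘⟨ arrow-merge p ⟩
      (⟦ π⁻¹ ⟧ ⊕ ⟦ π⁻¹ ⟧) ∘ [ f × U ] ∘ ⟦ E.⟨ t , u ⟩ ⟧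
        ≈⟨ refl⟩∘⟨ filter-⟨⟩ t u ⟩
      (⟦ π⁻¹ ⟧ ⊕ ⟦ π⁻¹ ⟧) ∘ (⟦ E.⟨ t , u ⟩ ⟧ ⊕ ⟦ E.⟨ t , u ⟩ ⟧) ∘ test t
        ≈⟨ pullˡ (⊗-merge (arrow-merge q) (arrow-merge q)) ⟩
      (⟦ h ⟧ ⊕ ⟦ h ⟧) ∘ test t ∎
      where
      π⁻¹ : E.Hom (F ++ U) R
      π⁻¹ = E.⌊ π E.⁻¹ₚ ⌋

      q : π⁻¹ E.∘ E.⟨ t , u ⟩ E.≈ h
      q = E.≈-trans (E.refl⟩∘⟨ E.≈-sym p) (E.cancelˡ (E.⁻¹ₚ-inverseˡ π))

    π₂-section : ∀ {T} (t : E.Hom T F) → ⟦ E.π₂ F T ⟧ ∘ ⟦ E.⟨ t , E.id ⟩ ⟧ ≈ id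
    π₂-section t = arrow-inverse E.π₂-⟨⟩

    test-merge : ∀ {T} (t : E.Hom T F) → J [ T ] ∘ test t ≈ id
    test-merge {T} t = begin
      J [ T ] ∘ (⟦ p ⟧ ⊕ ⟦ p ⟧) ∘ [ f × T ] ∘ ⟦ k ⟧  ≈⟨ extendʳ (J-∘-⊕ ⟦ p ⟧) ⟩
      ⟦ p ⟧ ∘ J [ F ++ T ] ∘ [ f × T ] ∘ ⟦ k ⟧      ≈⟨ refl⟩∘⟨ cancelˡ (axiom filter-merge) ⟩
      ⟦ p ⟧ ∘ ⟦ k ⟧                                 ≈⟨ π₂-section t ⟩
      id                                            ∎
      where
      p : E.Hom (F ++ T) T
      p = E.π₂ F T
      k : E.Hom T (F ++ T)
      k = E.⟨ t , E.id ⟩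

    module _ {T} (t : E.Hom T F) where

      private
        X : E.Obj
        X = F ++ T
        p : Hom [ X ] [ T ]
        p = ⟦ E.π₂ F T ⟧
        k : Hom [ T ] [ X ]
        k = ⟦ E.⟨ t , E.id ⟩ ⟧

        skip : ∀ {Y} → Hom (Y ∷ Y ∷ []) (Y ∷ Y ∷ Y ∷ [])
        skip {Y} = id {[ Y ]} ⊕ E₀ [ Y ] ⊕ id {[ Y ]}

        skip-natural : (p ⊕ (p ⊕ p)) ∘ skip ≈ skip ∘ (p ⊕ p)
        skip-natural = square-⊗ square-id
          (≈-trans (⊗-merge (≈-trans (axiom E-natural) (≈-sym identityʳ)) square-id)
            (≈-trans ⊗-∘ (refl⟩∘⟨ ⊗-unitˡ)))

      -- The axiom concerns two consecutive filters on the same columns. Inserting `p ∘ k` on the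
      -- second branch puts `k ⊕ k` after the outer test, and `filter-⟨⟩` folds these into one
      -- filter on `X`; the tested copy thus survives until the inner filter.
      test-preserveˡ : (test t ⊕ id) ∘ test t ≈ (id {[ T ]} ⊕ E₀ [ T ] ⊕ id {[ T ]}) ∘ test t
      test-preserveˡ = begin
        (test t ⊕ id) ∘ test t
          ≈⟨ ⊗-cong ≈-refl (π₂-section t) ⟩∘⟨refl ⟨
        (((p ⊕ p) ∘ [ f × T ] ∘ k) ⊕ (p ∘ k)) ∘ test t
          ≈⟨ pushˡ ⊗-∘ ⟩
        ((p ⊕ p) ⊕ p) ∘ (([ f × T ] ∘ k) ⊕ k) ∘ test t
          ≈⟨ refl⟩∘⟨ pushˡ (≈-trans (⊗-cong ≈-refl (≈-sym identityˡ)) ⊗-∘) ⟩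
        ((p ⊕ p) ⊕ p) ∘ ([ f × T ] ⊕ id {[ X ]}) ∘ (k ⊕ k) ∘ test t
          ≈⟨ refl⟩∘⟨ refl⟩∘⟨ filter-⟨⟩ t E.id ⟨
        ((p ⊕ p) ⊕ p) ∘ ([ f × T ] ⊕ id {[ X ]}) ∘ [ f × T ] ∘ k
          ≈⟨ refl⟩∘⟨ extendʳ (axiom filter-preserveˡ) ⟩
        ((p ⊕ p) ⊕ p) ∘ skip ∘ [ f × T ] ∘ k
          ≈⟨ unframe ⊗-assoc ⟩∘⟨refl ⟩
        (p ⊕ (p ⊕ p)) ∘ skip ∘ [ f × T ] ∘ k
          ≈⟨ extendʳ skip-natural ⟩
        skip ∘ test t ∎

      test-preserveʳ : (id ⊕ test t) ∘ test t ≈ (id {[ T ]} ⊕ E₀ [ T ] ⊕ id {[ T ]}) ∘ test t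
      test-preserveʳ = begin
        (id ⊕ test t) ∘ test t
          ≈⟨ ⊗-cong (π₂-section t) ≈-refl ⟩∘⟨refl ⟨
        ((p ∘ k) ⊕ ((p ⊕ p) ∘ [ f × T ] ∘ k)) ∘ test t
          ≈⟨ pushˡ ⊗-∘ ⟩
        (p ⊕ (p ⊕ p)) ∘ (k ⊕ ([ f × T ] ∘ k)) ∘ test t
          ≈⟨ refl⟩∘⟨ pushˡ (≈-trans (⊗-cong (≈-sym identityˡ) ≈-refl) ⊗-∘) ⟩
        (p ⊕ (p ⊕ p)) ∘ (id {[ X ]} ⊕ [ f × T ]) ∘ (k ⊕ k) ∘ test t
          ≈⟨ refl⟩∘⟨ refl⟩∘⟨ filter-⟨⟩ t E.id ⟨
        (p ⊕ (p ⊕ p)) ∘ (id {[ X ]} ⊕ [ f × T ]) ∘ [ f × T ] ∘ k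
          ≈⟨ refl⟩∘⟨ extendʳ (axiom filter-preserveʳ) ⟩
        (p ⊕ (p ⊕ p)) ∘ skip ∘ [ f × T ] ∘ k
          ≈⟨ extendʳ skip-natural ⟩
        skip ∘ test t ∎

  -- Brings the symmetry of `filter-comm` into the form in which naturality and `J-⊕` are available.
  interchange-singletons : ∀ T → interchange [ T ] [ T ] [ T ] [ T ] ≈ id {[ T ]} ⊕ σ [ T ] [ T ] ⊕ id {[ T ]}
  interchange-singletons T = ≈-trans identityˡ (≈-trans identityʳ
    (⊗-cong ≈-refl (≈-trans identityˡ identityʳ)))

  -- The axiom on commuting filters is applied to a table in which both
  -- tested tuples occupy columns of their own, in front of the row.

  module _ (f g : Filter) {T} (t : E.Hom T (type f)) (s : E.Hom T (type g)) where

    private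
      F G Y : E.Obj
      F = type f
      G = type g
      Y = F ++ (G ++ T)

      h : E.Hom T Y
      h = E.⟨ t , E.⟨ s , E.id ⟩ ⟩

      p : Hom [ Y ] [ T ]
      p = ⟦ E.π₂ G T E.∘ E.π₂ F (G ++ T) ⟧

      p∘h : p ∘ ⟦ h ⟧ ≈ id
      p∘h = arrow-inverse (E.≈-trans E.assoc (E.≈-trans (E.refl⟩∘⟨ E.π₂-⟨⟩) E.π₂-⟨⟩))

      p²∘h² : (p ⊕ p) ∘ (⟦ h ⟧ ⊕ ⟦ h ⟧) ≈ id
      p²∘h² = ≈-trans (⊗-merge p∘h p∘h) ⊗-id

      -- `filter-comm` demands column permutations of one common object, so the second tested tuple
      -- has to be brought to the front by a `Perm`.
      swap : E.Perm Y (G ++ (F ++ T))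
      swap = E.coeₚ (++-assoc G F T) E.∘ₚ ((E.σₚ F G E.⊗ₚ E.idₚ) E.∘ₚ E.coeₚ (sym (++-assoc F G T)))

      ⌊swap⌋ : E.⌊ swap ⌋ E.∘ h E.≈ E.⟨ s , E.⟨ t , E.id ⟩ ⟩
      ⌊swap⌋ rewrite E.⌊coeₚ⌋ (++-assoc G F T) | E.⌊coeₚ⌋ (sym (++-assoc F G T)) =
        E.≈-trans E.assoc (E.≈-trans (E.refl⟩∘⟨ E.≈-trans E.assoc (E.≈-trans (E.refl⟩∘⟨ E.⟨⟩-assoc⁻¹)
          (E.≈-trans E.×-∘-⟨⟩ (E.⟨⟩-cong E.σ-⟨⟩ E.identityˡ)))) E.⟨⟩-assoc)

      f⋆ g⋆ : Hom [ Y ] (Y ∷ Y ∷ [])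
      f⋆ = filterAt f E.idₚ
      g⋆ = filterAt g swap

      f⋆∘h : f⋆ ∘ ⟦ h ⟧ ≈ (⟦ h ⟧ ⊕ ⟦ h ⟧) ∘ test f t
      f⋆∘h = filterAt-∘ f E.idₚ E.identityˡ

      g⋆∘h : g⋆ ∘ ⟦ h ⟧ ≈ (⟦ h ⟧ ⊕ ⟦ h ⟧) ∘ test g s
      g⋆∘h = filterAt-∘ g swap ⌊swap⌋

      lift-square : ∀ {u : Hom [ T ] (T ∷ T ∷ [])} {u⋆ : Hom [ Y ] (Y ∷ Y ∷ [])} →
                    u⋆ ∘ ⟦ h ⟧ ≈ (⟦ h ⟧ ⊕ ⟦ h ⟧) ∘ u →
                    (u⋆ ⊕ u⋆) ∘ (⟦ h ⟧ ⊕ ⟦ h ⟧) ≈ ((⟦ h ⟧ ⊕ ⟦ h ⟧) ⊕ (⟦ h ⟧ ⊕ ⟦ h ⟧)) ∘ (u ⊕ u)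
      lift-square q = square-⊗ q q

      p⁴∘h⁴ : ((p ⊕ p) ⊕ (p ⊕ p)) ∘ ((⟦ h ⟧ ⊕ ⟦ h ⟧) ⊕ (⟦ h ⟧ ⊕ ⟦ h ⟧)) ≈ id
      p⁴∘h⁴ = ≈-trans (⊗-merge p²∘h² p²∘h²) ⊗-id

    test-comm : (test g s ⊕ test g s) ∘ test f t ≈
                interchange [ T ] [ T ] [ T ] [ T ] ∘ (test f t ⊕ test f t) ∘ test g s
    test-comm = begin
      (test g s ⊕ test g s) ∘ test f t
        -- `p` retracts `h`, so lifting all four rows to `Y` and projecting them back changes
        -- nothing; the axiom applies to the lifted filters.
        ≈⟨ cancelˡ p⁴∘h⁴ ⟨
      p⁴ ∘ h⁴ ∘ (test g s ⊕ test g s) ∘ test f t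
        ≈⟨ refl⟩∘⟨ extendʳ (lift-square g⋆∘h) ⟨
      p⁴ ∘ (g⋆ ⊕ g⋆) ∘ (⟦ h ⟧ ⊕ ⟦ h ⟧) ∘ test f t
        ≈⟨ refl⟩∘⟨ refl⟩∘⟨ f⋆∘h ⟨
      p⁴ ∘ (g⋆ ⊕ g⋆) ∘ f⋆ ∘ ⟦ h ⟧
        ≈⟨ refl⟩∘⟨ extendʳ (axiom filter-comm) ⟩
      p⁴ ∘ (id {[ Y ]} ⊕ σ [ Y ] [ Y ] ⊕ id {[ Y ]}) ∘ ((f⋆ ⊕ f⋆) ∘ g⋆) ∘ ⟦ h ⟧
        ≈⟨ refl⟩∘⟨ interchange-singletons Y ⟩∘⟨refl ⟨
      p⁴ ∘ interchange [ Y ] [ Y ] [ Y ] [ Y ] ∘ ((f⋆ ⊕ f⋆) ∘ g⋆) ∘ ⟦ h ⟧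
        ≈⟨ extendʳ (≈-sym interchange-natural) ⟩
      interchange [ T ] [ T ] [ T ] [ T ] ∘ p⁴ ∘ ((f⋆ ⊕ f⋆) ∘ g⋆) ∘ ⟦ h ⟧
        ≈⟨ refl⟩∘⟨ refl⟩∘⟨ ≈-trans assoc (refl⟩∘⟨ g⋆∘h) ⟩
      interchange [ T ] [ T ] [ T ] [ T ] ∘ p⁴ ∘ (f⋆ ⊕ f⋆) ∘ (⟦ h ⟧ ⊕ ⟦ h ⟧) ∘ test g s
        ≈⟨ refl⟩∘⟨ refl⟩∘⟨ extendʳ (lift-square f⋆∘h) ⟩
      interchange [ T ] [ T ] [ T ] [ T ] ∘ p⁴ ∘ h⁴ ∘ (test f t ⊕ test f t) ∘ test g s
        ≈⟨ refl⟩∘⟨ cancelˡ p⁴∘h⁴ ⟩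
      interchange [ T ] [ T ] [ T ] [ T ] ∘ (test f t ⊕ test f t) ∘ test g s ∎
      where
      p⁴ : Hom (Y ∷ Y ∷ Y ∷ Y ∷ []) (T ∷ T ∷ T ∷ T ∷ [])
      p⁴ = (p ⊕ p) ⊕ (p ⊕ p)
      h⁴ : Hom (T ∷ T ∷ T ∷ T ∷ []) (Y ∷ Y ∷ Y ∷ Y ∷ [])
      h⁴ = (⟦ h ⟧ ⊕ ⟦ h ⟧) ⊕ (⟦ h ⟧ ⊕ ⟦ h ⟧)

  -- Laws of the conditional

  choose : ∀ f {T B} → E.Hom T (type f) → Hom [ T ] B → Hom [ T ] B → Hom [ T ] B
  choose f {B = B} t m n = J B ∘ (m ⊕ n) ∘ test f t

  choose-cong : ∀ {f T B} {t : E.Hom T (type f)} {m m′ n n′ : Hom [ T ] B} →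
                m ≈ m′ → n ≈ n′ → choose f t m n ≈ choose f t m′ n′
  choose-cong p q = refl⟩∘⟨ ⊗-cong p q ⟩∘⟨refl

  choose-∘ : ∀ {f T B C} {t : E.Hom T (type f)} {m n : Hom [ T ] B} (d : Hom B C) →
             d ∘ choose f t m n ≈ choose f t (d ∘ m) (d ∘ n)
  choose-∘ d = ≈-trans (extendʳ (axiom J-natural)) (refl⟩∘⟨ pullˡ (≈-sym ⊗-∘))

  choose-idem : ∀ {f T B} {t : E.Hom T (type f)} {m : Hom [ T ] B} → choose f t m m ≈ m
  choose-idem {f} {t = t} {m} = ≈-trans (extendʳ (J-∘-⊕ m)) (elimʳ (test-merge f t))

  module _ {f T B} {t : E.Hom T (type f)} {l m n : Hom [ T ] B} where

    private
      -- The middle branch receives only the empty table: by naturality `m` becomes `E₀ B`, which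
      -- merging absorbs.
      skip-middle : J B ∘ (id ⊕ J B) ∘ (l ⊕ (m ⊕ n)) ∘ (id {[ T ]} ⊕ E₀ [ T ] ⊕ id {[ T ]}) ∘ test f t ≈
                    choose f t l n
      skip-middle = refl⟩∘⟨ ≈-trans (pullˡ (⊗-merge identityˡ ≈-refl)) (pullˡ (⊗-merge identityʳ
        (≈-trans assoc (≈-trans (refl⟩∘⟨ ⊗-merge (axiom E-natural) identityʳ) (J-E⊕ n)))))

    -- Reassociating the merges brings the two tests next to each other, where preservation of data
    -- replaces the inner one by an empty table in the position of `m`.
    choose-absorbˡ : choose f t (choose f t l m) n ≈ choose f t l n
    choose-absorbˡ = begin
      J B ∘ ((J B ∘ (l ⊕ m) ∘ test f t) ⊕ n) ∘ test f t
        ≈⟨ refl⟩∘⟨ pushˡ (≈-trans (⊗-cong ≈-refl (≈-sym identityˡ)) ⊗-∘) ⟩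
      J B ∘ (J B ⊕ id) ∘ (((l ⊕ m) ∘ test f t) ⊕ n) ∘ test f t
        ≈⟨ refl⟩∘⟨ refl⟩∘⟨ pushˡ (≈-trans (⊗-cong ≈-refl (≈-sym identityʳ)) ⊗-∘) ⟩
      J B ∘ (J B ⊕ id) ∘ ((l ⊕ m) ⊕ n) ∘ (test f t ⊕ id {[ T ]}) ∘ test f t
        ≈⟨ refl⟩∘⟨ refl⟩∘⟨ refl⟩∘⟨ test-preserveˡ f t ⟩
      J B ∘ (J B ⊕ id) ∘ ((l ⊕ m) ⊕ n) ∘ skip ∘ test f t
        ≈⟨ ≈-trans (extendʳ (axiom J-assoc)) (refl⟩∘⟨ assoc) ⟩
      J B ∘ (id ⊕ J B) ∘ α B B B ∘ ((l ⊕ m) ⊕ n) ∘ skip ∘ test f t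
        ≈⟨ refl⟩∘⟨ refl⟩∘⟨ pullˡ (≈-trans ⊗-assoc identityʳ) ⟩
      J B ∘ (id ⊕ J B) ∘ (l ⊕ (m ⊕ n)) ∘ skip ∘ test f t
        ≈⟨ skip-middle ⟩
      choose f t l n ∎
      where
      skip : Hom (T ∷ T ∷ []) (T ∷ T ∷ T ∷ [])
      skip = id {[ T ]} ⊕ E₀ [ T ] ⊕ id {[ T ]}

    choose-absorbʳ : choose f t l (choose f t m n) ≈ choose f t l n
    choose-absorbʳ = begin
      J B ∘ (l ⊕ (J B ∘ (m ⊕ n) ∘ test f t)) ∘ test f t
        ≈⟨ refl⟩∘⟨ pushˡ (≈-trans (⊗-cong (≈-sym identityˡ) ≈-refl) ⊗-∘) ⟩
      J B ∘ (id ⊕ J B) ∘ (l ⊕ ((m ⊕ n) ∘ test f t)) ∘ test f t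
        ≈⟨ refl⟩∘⟨ refl⟩∘⟨ pushˡ (≈-trans (⊗-cong (≈-sym identityʳ) ≈-refl) ⊗-∘) ⟩
      J B ∘ (id ⊕ J B) ∘ (l ⊕ (m ⊕ n)) ∘ (id {[ T ]} ⊕ test f t) ∘ test f t
        ≈⟨ refl⟩∘⟨ refl⟩∘⟨ refl⟩∘⟨ test-preserveʳ f t ⟩
      J B ∘ (id ⊕ J B) ∘ (l ⊕ (m ⊕ n)) ∘ (id {[ T ]} ⊕ E₀ [ T ] ⊕ id {[ T ]}) ∘ test f t
        ≈⟨ skip-middle ⟩
      choose f t l n ∎

  -- Commuting the tests permutes the four outcomes, and the total merge does not see this
  -- permutation.
  choose-comm : ∀ {f g T B} {t : E.Hom T (type f)} {s : E.Hom T (type g)} {k l m n : Hom [ T ] B} →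
                choose f t (choose g s k l) (choose g s m n) ≈
                choose g s (choose f t k m) (choose f t l n)
  choose-comm {f} {g} {T} {B} {t} {s} {k} {l} {m} {n} = begin
    J B ∘ (choose g s k l ⊕ choose g s m n) ∘ test f t
      ≈⟨ refl⟩∘⟨ split ⟩
    J B ∘ (J B ⊕ J B) ∘ ((k ⊕ l) ⊕ (m ⊕ n)) ∘ (test g s ⊕ test g s) ∘ test f t
      ≈⟨ refl⟩∘⟨ refl⟩∘⟨ refl⟩∘⟨ test-comm f g t s ⟩
    J B ∘ (J B ⊕ J B) ∘ ((k ⊕ l) ⊕ (m ⊕ n)) ∘ interchange [ T ] [ T ] [ T ] [ T ] ∘
      (test f t ⊕ test f t) ∘ test g s
      ≈⟨ refl⟩∘⟨ refl⟩∘⟨ extendʳ (≈-sym interchange-natural) ⟩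
    J B ∘ (J B ⊕ J B) ∘ interchange B B B B ∘ ((k ⊕ m) ⊕ (l ⊕ n)) ∘ (test f t ⊕ test f t) ∘ test g s
      -- The interchange is absorbed into the merge at `B ++ B`; naturality of merging with respect
      -- to `J B` itself then restores `J B ⊕ J B`.
      ≈⟨ refl⟩∘⟨ pullˡ (≈-sym (axiom J-⊕)) ⟩
    J B ∘ J (B ++ B) ∘ ((k ⊕ m) ⊕ (l ⊕ n)) ∘ (test f t ⊕ test f t) ∘ test g s
      ≈⟨ extendʳ (axiom J-natural) ⟩
    J B ∘ (J B ⊕ J B) ∘ ((k ⊕ m) ⊕ (l ⊕ n)) ∘ (test f t ⊕ test f t) ∘ test g s
      ≈⟨ refl⟩∘⟨ split ⟨
    J B ∘ (choose f t k m ⊕ choose f t l n) ∘ test g s ∎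
    where
    split : ∀ {h} {u : E.Hom T (type h)} {C} {a b c d : Hom [ T ] B} {z : Hom C (T ∷ T ∷ [])} →
            (choose h u a b ⊕ choose h u c d) ∘ z ≈
            (J B ⊕ J B) ∘ ((a ⊕ b) ⊕ (c ⊕ d)) ∘ (test h u ⊕ test h u) ∘ z
    split = ≈-trans (pushˡ ⊗-∘) (refl⟩∘⟨ pushˡ ⊗-∘)

-- Soundness

-- Replaces the case distinction on a decision by one on a Boolean, which later arguments can
-- generalise over.
evalFilter-does : ∀ {ℓ} {S : Signature ℓ} (em : ExcludedMiddle ℓ) (V : Valuation S) f U x →
                  evalFilter V em f U x ≡
                  (if does (em {Valuation.filter V f (proj₁ (All.++⁻ (Signature.type S f) x))})
                   then here x else there (here x))
evalFilter-does {S = S} em V f U x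
  with em {Valuation.filter V f (proj₁ (All.++⁻ (Signature.type S f) x))}
... | yes _ = refl
... | no _  = refl

-- The decision returned by `em` is opaque, but its truth value is forced. A Boolean choice of tests
-- can thus be prescribed through the subsets of a valuation.
does-em-≡true : ∀ {ℓ} (em : ExcludedMiddle ℓ) b → does (em {Lift ℓ (b ≡ true)}) ≡ b
does-em-≡true {ℓ} em b with em {Lift ℓ (b ≡ true)}
does-em-≡true em true  | yes _ = refl
does-em-≡true em false | yes ()
does-em-≡true em true  | no ¬p = contradiction (lift refl) ¬p
does-em-≡true em false | no _  = refl

-- Tuples and rows over concatenated lists

module _ {a p : Level} {X : Set a} {P : X → Set p} where

  All-++⁻-++⁺ : ∀ {xs ys} (y : All P xs) (z : All P ys) → All.++⁻ xs (All.++⁺ y z) ≡ (y , z)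
  All-++⁻-++⁺ y z = Inverse.strictlyInverseʳ All.++↔ (y , z)

  -- Evaluation splits its argument by `All.++⁻`; on an explicit append the split can be rewritten
  -- away.
  All-++-elim : ∀ {q} xs {ys} (Q : All P (xs ++ ys) → Set q) →
                (∀ y z → Q (All.++⁺ y z)) → ∀ x → Q x
  All-++-elim xs Q q x =
    subst Q (Inverse.strictlyInverseˡ (All.++↔ {xs = xs}) x)
      (q (proj₁ (All.++⁻ xs x)) (proj₂ (All.++⁻ xs x)))

  All-++-elim₃ : ∀ {q} xs ys {zs} (Q : All P ((xs ++ ys) ++ zs) → Set q) →
                 (∀ x y z → Q (All.++⁺ (All.++⁺ {xs = xs} {ys = ys} x y) z)) → ∀ x → Q x
  All-++-elim₃ xs ys Q q = All-++-elim (xs ++ ys) Q λ xy z →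
    All-++-elim xs (λ xy → Q (All.++⁺ xy z)) (λ x y → q x y z) xy

  Any-++⁻-++⁺ˡ : ∀ {xs ys} (y : Any P xs) → Any.++⁻ xs {ys} (Any.++⁺ˡ y) ≡ inj₁ y
  Any-++⁻-++⁺ˡ {xs} y = Any.++⁻∘++⁺ xs (inj₁ y)

  Any-++⁻-++⁺ʳ : ∀ xs {ys} (z : Any P ys) → Any.++⁻ xs (Any.++⁺ʳ xs z) ≡ inj₂ z
  Any-++⁻-++⁺ʳ xs z = Any.++⁻∘++⁺ xs (inj₂ z)

  Any-++-elim : ∀ {q} xs {ys} (Q : Any P (xs ++ ys) → Set q) →
                (∀ y → Q (Any.++⁺ˡ y)) → (∀ z → Q (Any.++⁺ʳ xs z)) → ∀ x → Q x
  Any-++-elim xs Q l r x with Any.++⁻ xs x | Any.++⁺∘++⁻ xs x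
  ... | inj₁ y | refl = l y
  ... | inj₂ z | refl = r z

-- The laws of ℰ under a valuation

module ℰSoundness {ℓ : Level} {S : Signature ℓ} (V : Valuation S) where
  open Signature S
  open ℰ S
  open Valuation V

  private
    ⟦_⟧ : Obj → Set ℓ
    ⟦_⟧ = All datatype

    eval : ∀ {T U} → Hom T U → ⟦ T ⟧ → ⟦ U ⟧
    eval = evalᴱ V

  eval-coe-∷ : ∀ {t T U} (p : T ≡ U) (a : datatype t) (x : ⟦ T ⟧) →
               eval (coe (cong (t ∷_) p)) (a ∷ x) ≡ a ∷ eval (coe p) x
  eval-coe-∷ refl a x = refl

  eval-coe-sym : ∀ {T U} (p : T ≡ U) (x : ⟦ T ⟧) → eval (coe (sym p)) (eval (coe p) x) ≡ x
  eval-coe-sym refl x = refl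

  eval-α : ∀ {T U W} (x : ⟦ T ⟧) (y : ⟦ U ⟧) (z : ⟦ W ⟧) →
           eval (α T U W) (All.++⁺ (All.++⁺ x y) z) ≡ All.++⁺ x (All.++⁺ y z)
  eval-α []      y z = refl
  eval-α {_ ∷ T} {U} {W} (a ∷ x) y z =
    trans (eval-coe-∷ (++-assoc T U W) a _) (cong (a ∷_) (eval-α x y z))

  eval-α⁻¹ : ∀ {T U W} (x : ⟦ T ⟧) (y : ⟦ U ⟧) (z : ⟦ W ⟧) →
             eval (α⁻¹ T U W) (All.++⁺ x (All.++⁺ y z)) ≡ All.++⁺ (All.++⁺ x y) z
  eval-α⁻¹ {T} {U} {W} x y z =
    trans (cong (eval (α⁻¹ T U W)) (sym (eval-α x y z))) (eval-coe-sym (++-assoc T U W) _)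

  eval-ρ : ∀ {T} (x : ⟦ T ⟧) → eval (ρ T) (All.++⁺ x []) ≡ x
  eval-ρ []      = refl
  eval-ρ {_ ∷ T} (a ∷ x) = trans (eval-coe-∷ (++-identityʳ T) a _) (cong (a ∷_) (eval-ρ x))

  eval-× : ∀ {T U T′ U′} (h : Hom T U) (k : Hom T′ U′) (x : ⟦ T ⟧) (y : ⟦ T′ ⟧) →
           eval (h × k) (All.++⁺ x y) ≡ All.++⁺ (eval h x) (eval k y)
  eval-× h k x y rewrite All-++⁻-++⁺ x y = refl

  eval-σ : ∀ {T U} (x : ⟦ T ⟧) (y : ⟦ U ⟧) → eval (σ T U) (All.++⁺ x y) ≡ All.++⁺ y x
  eval-σ x y rewrite All-++⁻-++⁺ x y = refl

  eval-interchange : ∀ {T U W Y} (x : ⟦ T ⟧) (y : ⟦ U ⟧) (z : ⟦ W ⟧) (w : ⟦ Y ⟧) →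
    eval (interchange T U W Y) (All.++⁺ (All.++⁺ x y) (All.++⁺ z w)) ≡
    All.++⁺ (All.++⁺ x z) (All.++⁺ y w)
  eval-interchange {T} {U} {W} {Y} x y z w
    rewrite eval-α x y (All.++⁺ z w)
          | All-++⁻-++⁺ x (All.++⁺ y (All.++⁺ z w))
          | eval-α⁻¹ y z w
          | All-++⁻-++⁺ (All.++⁺ y z) w
          | All-++⁻-++⁺ y z
          | eval-α z y w
          = eval-α⁻¹ x z (All.++⁺ y w)

  eval-axiom : ∀ {T U} {h k : Hom T U} → h ∼ k → ∀ x → eval h x ≡ eval k x
  eval-axiom δ-assoc x rewrite All-++⁻-++⁺ x x = eval-α x x x
  eval-axiom δ-unitˡ x rewrite All-++⁻-++⁺ x x = refl
  eval-axiom δ-unitʳ x rewrite All-++⁻-++⁺ x x = eval-ρ x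
  eval-axiom δ-comm x rewrite All-++⁻-++⁺ x x = refl
  eval-axiom δ-natural x rewrite All-++⁻-++⁺ x x = refl
  eval-axiom ⊥-natural x = refl
  eval-axiom δ-unit [] = refl
  eval-axiom ⊥-unit [] = refl
  eval-axiom (δ-× {T} {U}) = All-++-elim T _ λ y z →
    sym (trans (cong (eval (interchange T T U U)) (eval-× (δ T) (δ U) y z)) (eval-interchange y y z z))
  eval-axiom (⊥-× {T} {U}) = All-++-elim T _ λ y z → sym (eval-× (⊥ T) (⊥ U) y z)

  eval-≈ : ∀ {T U} {h k : Hom T U} → h ≈ k → ∀ x → eval h x ≡ eval k x
  eval-≈ (axiom p) x = eval-axiom p x
  eval-≈ ≈-refl x = refl
  eval-≈ (≈-sym p) x = sym (eval-≈ p x)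
  eval-≈ (≈-trans p q) x = trans (eval-≈ p x) (eval-≈ q x)
  eval-≈ (∘-cong {f′ = f′} p q) x = trans (eval-≈ p _) (cong (eval f′) (eval-≈ q x))
  eval-≈ (⊗-cong {A = A} p q) x = cong₂ All.++⁺ (eval-≈ p (proj₁ (All.++⁻ A x))) (eval-≈ q (proj₂ (All.++⁻ A x)))
  eval-≈ identityˡ x = refl
  eval-≈ identityʳ x = refl
  eval-≈ assoc x = refl
  eval-≈ (⊗-id {A}) x = Inverse.strictlyInverseˡ (All.++↔ {xs = A}) x
  eval-≈ (⊗-∘ {A} {f = f} {h} {f′} {h′}) = All-++-elim A _ λ y z →
    trans (eval-× (f ∘ h) (f′ ∘ h′) y z)
      (sym (trans (cong (eval (f × f′)) (eval-× h h′ y z)) (eval-× f f′ _ _)))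
  eval-≈ (⊗-assoc {A} {B} {C} {A′} {B′} {C′} {f} {h} {k}) = All-++-elim₃ A B _ assoc-case
    where
    assoc-case : (x : ⟦ A ⟧) (y : ⟦ B ⟧) (z : ⟦ C ⟧) →
                 eval (α A′ B′ C′ ∘ ((f × h) × k)) (All.++⁺ (All.++⁺ x y) z) ≡
                 eval ((f × (h × k)) ∘ α A B C) (All.++⁺ (All.++⁺ x y) z)
    assoc-case x y z
      rewrite All-++⁻-++⁺ (All.++⁺ x y) z | All-++⁻-++⁺ x y | eval-α x y z
            | All-++⁻-++⁺ x (All.++⁺ y z) | All-++⁻-++⁺ y z = eval-α (eval f x) (eval h y) (eval k z)
  eval-≈ ⊗-unitˡ x = refl
  eval-≈ (⊗-unitʳ {A} {B} {f}) = All-++-elim A _ λ { y [] →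
    trans (cong (eval (ρ B)) (eval-× f id y []))
      (trans (eval-ρ (eval f y)) (cong (eval f) (sym (eval-ρ y)))) }
  eval-≈ (σ-natural {A} {B} {C} {D} {f} {h}) = All-++-elim A _ λ y z →
    trans (cong (eval (σ B D)) (eval-× f h y z))
      (trans (eval-σ (eval f y) (eval h z)) (sym (trans (cong (eval (h × f)) (eval-σ y z)) (eval-× h f z y))))
  eval-≈ (σ-involutive {A} {B}) = All-++-elim A _ λ y z →
    trans (cong (eval (σ B A)) (eval-σ y z)) (eval-σ z y)
  eval-≈ (σ-unit {A}) = All-++-elim A _ λ { y [] → trans (eval-σ y []) (sym (eval-ρ y)) }
  eval-≈ (σ-hexagon {A} {B} {C}) = All-++-elim₃ A B _ hexagon-case
    where
    hexagon-case : (x : ⟦ A ⟧) (y : ⟦ B ⟧) (z : ⟦ C ⟧) →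
                   eval (α B C A ∘ σ A (B ++ C) ∘ α A B C) (All.++⁺ (All.++⁺ x y) z) ≡
                   eval ((id {B} × σ A C) ∘ α B A C ∘ (σ A B × id {C})) (All.++⁺ (All.++⁺ x y) z)
    hexagon-case x y z
      rewrite eval-α x y z | All-++⁻-++⁺ x (All.++⁺ y z) | eval-α y z x
            | All-++⁻-++⁺ (All.++⁺ x y) z | All-++⁻-++⁺ x y | eval-α y x z
            | All-++⁻-++⁺ y (All.++⁺ x z) | All-++⁻-++⁺ x z = refl

-- The laws of ℱ under a valuation

module ℱSoundness {ℓ : Level} {S : Signature ℓ} (em : ExcludedMiddle ℓ) (V : Valuation S) where
  open Signature S
  open ℱ S
  private
    module E where
      open ℰ S public
      open ℰProperties S public
      open ℰSoundness V public

    ⟨_⟩ : Obj → Set ℓ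
    ⟨_⟩ = ⟦_⟧ᶠ V

    eval : ∀ {A B} → Hom A B → ⟨ A ⟩ → ⟨ B ⟩
    eval = evalᶠ V em

  eval-coe-here : ∀ {T A B} (p : A ≡ B) x → eval (coe (cong (T ∷_) p)) (here x) ≡ here x
  eval-coe-here refl x = refl

  eval-coe-there : ∀ {T A B} (p : A ≡ B) x →
                   eval (coe (cong (T ∷_) p)) (there x) ≡ there (eval (coe p) x)
  eval-coe-there refl x = refl

  eval-coe-sym : ∀ {A B} (p : A ≡ B) x → eval (coe (sym p)) (eval (coe p) x) ≡ x
  eval-coe-sym refl x = refl

  module _ (A B C : Obj) where

    first : ⟨ A ⟩ → ⟨ (A ++ B) ++ C ⟩
    first x = Any.++⁺ˡ (Any.++⁺ˡ x)

    second : ⟨ B ⟩ → ⟨ (A ++ B) ++ C ⟩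
    second x = Any.++⁺ˡ (Any.++⁺ʳ A x)

    third : ⟨ C ⟩ → ⟨ (A ++ B) ++ C ⟩
    third x = Any.++⁺ʳ (A ++ B) x

    first′ : ⟨ A ⟩ → ⟨ A ++ (B ++ C) ⟩
    first′ x = Any.++⁺ˡ x

    second′ : ⟨ B ⟩ → ⟨ A ++ (B ++ C) ⟩
    second′ x = Any.++⁺ʳ A (Any.++⁺ˡ x)

    third′ : ⟨ C ⟩ → ⟨ A ++ (B ++ C) ⟩
    third′ x = Any.++⁺ʳ A (Any.++⁺ʳ B x)

    elim₃ : (Q : ⟨ (A ++ B) ++ C ⟩ → Set ℓ) →
            (∀ x → Q (first x)) → (∀ x → Q (second x)) → (∀ x → Q (third x)) → ∀ x → Q x
    elim₃ Q q₁ q₂ q₃ =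
      Any-++-elim (A ++ B) Q (Any-++-elim A (λ x → Q (Any.++⁺ˡ x)) q₁ q₂) q₃

  eval-α₁ : ∀ A B C x → eval (α A B C) (first A B C x) ≡ first′ A B C x
  eval-α₁ (T ∷ A) B C (here x)  = eval-coe-here (++-assoc A B C) x
  eval-α₁ (T ∷ A) B C (there x) =
    trans (eval-coe-there (++-assoc A B C) _) (cong there (eval-α₁ A B C x))

  eval-α₂ : ∀ A B C x → eval (α A B C) (second A B C x) ≡ second′ A B C x
  eval-α₂ []      B C x = refl
  eval-α₂ (T ∷ A) B C x =
    trans (eval-coe-there (++-assoc A B C) _) (cong there (eval-α₂ A B C x))

  eval-α₃ : ∀ A B C x → eval (α A B C) (third A B C x) ≡ third′ A B C x
  eval-α₃ []      B C x = refl
  eval-α₃ (T ∷ A) B C x =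
    trans (eval-coe-there (++-assoc A B C) _) (cong there (eval-α₃ A B C x))

  module _ (A B C : Obj) where

    eval-α⁻¹ : ∀ {x y} → eval (α A B C) x ≡ y → eval (α⁻¹ A B C) y ≡ x
    eval-α⁻¹ {x} refl = eval-coe-sym (++-assoc A B C) x

    eval-α⁻¹₁ : ∀ x → eval (α⁻¹ A B C) (first′ A B C x) ≡ first A B C x
    eval-α⁻¹₁ x = eval-α⁻¹ (eval-α₁ A B C x)

    eval-α⁻¹₂ : ∀ x → eval (α⁻¹ A B C) (second′ A B C x) ≡ second A B C x
    eval-α⁻¹₂ x = eval-α⁻¹ (eval-α₂ A B C x)

    eval-α⁻¹₃ : ∀ x → eval (α⁻¹ A B C) (third′ A B C x) ≡ third A B C x
    eval-α⁻¹₃ x = eval-α⁻¹ (eval-α₃ A B C x)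

  eval-ρ : ∀ A x → eval (ρ A) (Any.++⁺ˡ x) ≡ x
  eval-ρ (T ∷ A) (here x)  = eval-coe-here (++-identityʳ A) x
  eval-ρ (T ∷ A) (there x) = trans (eval-coe-there (++-identityʳ A) _) (cong there (eval-ρ A x))

  eval-⊕ˡ : ∀ {A B C D} (d : Hom A B) (e : Hom C D) x →
            eval (d ⊕ e) (Any.++⁺ˡ x) ≡ Any.++⁺ˡ (eval d x)
  eval-⊕ˡ d e x = cong [ _ , _ ]′ (Any-++⁻-++⁺ˡ x)

  eval-⊕ʳ : ∀ {A B C D} (d : Hom A B) (e : Hom C D) x →
            eval (d ⊕ e) (Any.++⁺ʳ A x) ≡ Any.++⁺ʳ B (eval e x)
  eval-⊕ʳ {A} d e x = cong [ _ , _ ]′ (Any-++⁻-++⁺ʳ A x)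

  eval-σˡ : ∀ A B x → eval (σ A B) (Any.++⁺ˡ x) ≡ Any.++⁺ʳ B x
  eval-σˡ A B x = cong [ _ , _ ]′ (Any-++⁻-++⁺ˡ x)

  eval-σʳ : ∀ A B x → eval (σ A B) (Any.++⁺ʳ A x) ≡ Any.++⁺ˡ x
  eval-σʳ A B x = cong [ _ , _ ]′ (Any-++⁻-++⁺ʳ A x)

  eval-Jˡ : ∀ A x → eval (J A) (Any.++⁺ˡ x) ≡ x
  eval-Jˡ A x = cong Sum.reduce (Any-++⁻-++⁺ˡ x)

  eval-Jʳ : ∀ A x → eval (J A) (Any.++⁺ʳ A x) ≡ x
  eval-Jʳ A x = cong Sum.reduce (Any-++⁻-++⁺ʳ A x)

  module _ (A B C D : Obj) where

    private
      middle : Hom (B ++ (C ++ D)) (C ++ (B ++ D))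
      middle = α C B D ∘ (σ B C ⊕ id {D}) ∘ α⁻¹ B C D

      middle₁ : ∀ x → eval middle (first′ B C D x) ≡ second′ C B D x
      middle₁ x rewrite eval-α⁻¹₁ B C D x | eval-⊕ˡ (σ B C) (id {D}) (Any.++⁺ˡ x) | eval-σˡ B C x =
        eval-α₂ C B D x

      middle₂ : ∀ x → eval middle (second′ B C D x) ≡ first′ C B D x
      middle₂ x rewrite eval-α⁻¹₂ B C D x | eval-⊕ˡ (σ B C) (id {D}) (Any.++⁺ʳ B x) | eval-σʳ B C x =
        eval-α₁ C B D x

      middle₃ : ∀ x → eval middle (third′ B C D x) ≡ third′ C B D x
      middle₃ x rewrite eval-α⁻¹₃ B C D x | eval-⊕ʳ (σ B C) (id {D}) x = eval-α₃ C B D x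

    eval-interchange₁ : ∀ x → eval (interchange A B C D) (Any.++⁺ˡ (Any.++⁺ˡ x)) ≡ Any.++⁺ˡ (Any.++⁺ˡ x)
    eval-interchange₁ x rewrite eval-α₁ A B (C ++ D) x | eval-⊕ˡ (id {A}) middle x =
      eval-α⁻¹₁ A C (B ++ D) x

    eval-interchange₂ : ∀ x → eval (interchange A B C D) (Any.++⁺ˡ (Any.++⁺ʳ A x)) ≡
                              Any.++⁺ʳ (A ++ C) (Any.++⁺ˡ x)
    eval-interchange₂ x
      rewrite eval-α₂ A B (C ++ D) x | eval-⊕ʳ (id {A}) middle (Any.++⁺ˡ x) | middle₁ x =
      eval-α⁻¹₃ A C (B ++ D) (Any.++⁺ˡ x)

    eval-interchange₃ : ∀ x → eval (interchange A B C D) (Any.++⁺ʳ (A ++ B) (Any.++⁺ˡ x)) ≡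
                              Any.++⁺ˡ (Any.++⁺ʳ A x)
    eval-interchange₃ x
      rewrite eval-α₃ A B (C ++ D) (Any.++⁺ˡ x) | eval-⊕ʳ (id {A}) middle (second′ B C D x) | middle₂ x =
      eval-α⁻¹₂ A C (B ++ D) x

    eval-interchange₄ : ∀ x → eval (interchange A B C D) (Any.++⁺ʳ (A ++ B) (Any.++⁺ʳ C x)) ≡
                              Any.++⁺ʳ (A ++ C) (Any.++⁺ʳ B x)
    eval-interchange₄ x
      rewrite eval-α₃ A B (C ++ D) (Any.++⁺ʳ C x) | eval-⊕ʳ (id {A}) middle (third′ B C D x) | middle₃ x =
      eval-α⁻¹₃ A C (B ++ D) (Any.++⁺ʳ B x)

  branch : ∀ {T} → Bool → ⟦_⟧ᴱ V T → ⟨ T ∷ T ∷ [] ⟩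
  branch b x = if b then here x else there (here x)

  passes : ∀ f → ⟦_⟧ᴱ V (type f) → Bool
  passes f y = does (em {Valuation.filter V f y})

  eval-filter : ∀ f U (y : ⟦_⟧ᴱ V (type f)) (z : ⟦_⟧ᴱ V U) →
                eval [ f × U ] (here (All.++⁺ y z)) ≡ branch (passes f y) (All.++⁺ y z)
  eval-filter f U y z = trans (evalFilter-does em V f U (All.++⁺ y z))
    (cong (λ p → branch (passes f (proj₁ p)) (All.++⁺ y z)) (All-++⁻-++⁺ y z))

  eval-⊕-branch : ∀ {T U} (h : E.Hom T U) b x →
                  eval (⟦ h ⟧ ⊕ ⟦ h ⟧) (branch b x) ≡ branch b (evalᴱ V h x)
  eval-⊕-branch h true  x = refl
  eval-⊕-branch h false x = refl

  -- Common core of `filter-disjoint` and `filter-copy`: since `h` keeps the tuple `y` in front,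
  -- filtering before or after it selects the same branch.
  filter-natural : ∀ f {U W} (h : E.Hom (type f ++ U) (type f ++ W))
    (k : ⟦_⟧ᴱ V (type f) → ⟦_⟧ᴱ V U → ⟦_⟧ᴱ V W) →
    (∀ y z → evalᴱ V h (All.++⁺ y z) ≡ All.++⁺ y (k y z)) →
    ∀ x → eval ((⟦ h ⟧ ⊕ ⟦ h ⟧) ∘ [ f × U ]) (here x) ≡ eval ([ f × W ] ∘ ⟦ h ⟧) (here x)
  filter-natural f {U} {W} h k p =
    All-++-elim (type f) (λ x → eval ((⟦ h ⟧ ⊕ ⟦ h ⟧) ∘ [ f × U ]) (here x) ≡
                                eval ([ f × W ] ∘ ⟦ h ⟧) (here x)) λ y z →
      trans (cong (eval (⟦ h ⟧ ⊕ ⟦ h ⟧)) (eval-filter f U y z))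
        (trans (eval-⊕-branch h (passes f y) (All.++⁺ y z))
          (trans (cong (branch (passes f y)) (p y z))
            (sym (trans (cong (λ x → eval [ f × W ] (here x)) (p y z)) (eval-filter f W y (k y z))))))

  -- The Boolean can stay existential: commutation needs only that the row comes back unchanged, as
  -- `π⁻¹` undoes `π`, on one of the two sides.
  eval-filterAt : ∀ f {T U} (π : E.Perm T (type f ++ U)) x →
                  ∃ λ b → eval (filterAt f π) (here x) ≡ branch b x
  eval-filterAt f {T} {U} π x = b ,
    trans (cong (eval (⟦ π⁻¹ ⟧ ⊕ ⟦ π⁻¹ ⟧)) (evalFilter-does em V f U y))
      (trans (eval-⊕-branch π⁻¹ b y) (cong (branch b) (E.eval-≈ (E.⁻¹ₚ-inverseˡ π) x)))
    where
    π⁻¹ : E.Hom (type f ++ U) T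
    π⁻¹ = E.⌊ π E.⁻¹ₚ ⌋
    y : ⟦_⟧ᴱ V (type f ++ U)
    y = evalᴱ V E.⌊ π ⌋ x
    b : Bool
    b = passes f (proj₁ (All.++⁻ (type f) y))

  eval-axiom : ∀ {A B} {d e : Hom A B} → d ∼ e → ∀ x → eval d x ≡ eval e x
  eval-axiom (J-assoc {A}) = elim₃ A A A _ case₁ case₂ case₃
    where
    case₁ : ∀ x → eval (J A ∘ (J A ⊕ id {A})) (first A A A x) ≡
                  eval (J A ∘ (id {A} ⊕ J A) ∘ α A A A) (first A A A x)
    case₁ x rewrite eval-⊕ˡ (J A) (id {A}) (Any.++⁺ˡ x) | eval-Jˡ A x | eval-α₁ A A A x
      | eval-⊕ˡ (id {A}) (J A) x = refl
    case₂ : ∀ x → eval (J A ∘ (J A ⊕ id {A})) (second A A A x) ≡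
                  eval (J A ∘ (id {A} ⊕ J A) ∘ α A A A) (second A A A x)
    case₂ x rewrite eval-⊕ˡ (J A) (id {A}) (Any.++⁺ʳ A x) | eval-Jʳ A x | eval-α₂ A A A x
      | eval-⊕ʳ (id {A}) (J A) (Any.++⁺ˡ x) | eval-Jˡ A x | eval-Jʳ A x = refl
    case₃ : ∀ x → eval (J A ∘ (J A ⊕ id {A})) (third A A A x) ≡
                  eval (J A ∘ (id {A} ⊕ J A) ∘ α A A A) (third A A A x)
    case₃ x rewrite eval-⊕ʳ (J A) (id {A}) x | eval-α₃ A A A x
      | eval-⊕ʳ (id {A}) (J A) (Any.++⁺ʳ A x) | eval-Jʳ A x | eval-Jʳ A x = refl
  eval-axiom (J-unitˡ {A}) x = eval-Jʳ A x
  eval-axiom (J-unitʳ {A}) = Any-++-elim A _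
    (λ x → trans (cong (eval (J A)) (eval-⊕ˡ (id {A}) (E₀ A) x))
      (trans (eval-Jˡ A x) (sym (eval-ρ A x)))) λ ()
  eval-axiom (J-comm {A}) = Any-++-elim A _
    (λ x → trans (cong (eval (J A)) (eval-σˡ A A x)) (trans (eval-Jʳ A x) (sym (eval-Jˡ A x))))
    (λ x → trans (cong (eval (J A)) (eval-σʳ A A x)) (trans (eval-Jˡ A x) (sym (eval-Jʳ A x))))
  eval-axiom (J-natural {A} {B} {h}) = Any-++-elim A _
    (λ x → trans (cong (eval h) (eval-Jˡ A x))
      (sym (trans (cong (eval (J B)) (eval-⊕ˡ h h x)) (eval-Jˡ B _))))
    (λ x → trans (cong (eval h) (eval-Jʳ A x))
      (sym (trans (cong (eval (J B)) (eval-⊕ʳ h h x)) (eval-Jʳ B _))))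
  eval-axiom E-natural ()
  eval-axiom J-unit ()
  eval-axiom E-unit ()
  eval-axiom (J-⊕ {A} {B}) = Any-++-elim (A ++ B) _
    (Any-++-elim A _ case₁ case₂) (Any-++-elim A _ case₃ case₄)
    where
    K : Hom ((A ++ B) ++ (A ++ B)) (A ++ B)
    K = (J A ⊕ J B) ∘ interchange A B A B
    case₁ : (x : ⟨ A ⟩) → eval (J (A ++ B)) (Any.++⁺ˡ (Any.++⁺ˡ x)) ≡ eval K (Any.++⁺ˡ (Any.++⁺ˡ x))
    case₁ x rewrite eval-Jˡ (A ++ B) (Any.++⁺ˡ x) | eval-interchange₁ A B A B x
      | eval-⊕ˡ (J A) (J B) (Any.++⁺ˡ x) | eval-Jˡ A x = refl
    case₂ : (x : ⟨ B ⟩) → eval (J (A ++ B)) (Any.++⁺ˡ (Any.++⁺ʳ A x)) ≡ eval K (Any.++⁺ˡ (Any.++⁺ʳ A x))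
    case₂ x rewrite eval-Jˡ (A ++ B) (Any.++⁺ʳ A x) | eval-interchange₂ A B A B x
      | eval-⊕ʳ (J A) (J B) (Any.++⁺ˡ x) | eval-Jˡ B x = refl
    case₃ : (x : ⟨ A ⟩) → eval (J (A ++ B)) (Any.++⁺ʳ (A ++ B) (Any.++⁺ˡ x)) ≡
                  eval K (Any.++⁺ʳ (A ++ B) (Any.++⁺ˡ x))
    case₃ x rewrite eval-Jʳ (A ++ B) (Any.++⁺ˡ x) | eval-interchange₃ A B A B x
      | eval-⊕ˡ (J A) (J B) (Any.++⁺ʳ A x) | eval-Jʳ A x = refl
    case₄ : (x : ⟨ B ⟩) → eval (J (A ++ B)) (Any.++⁺ʳ (A ++ B) (Any.++⁺ʳ A x)) ≡
                  eval K (Any.++⁺ʳ (A ++ B) (Any.++⁺ʳ A x))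
    case₄ x rewrite eval-Jʳ (A ++ B) (Any.++⁺ʳ A x) | eval-interchange₄ A B A B x
      | eval-⊕ʳ (J A) (J B) (Any.++⁺ʳ B x) | eval-Jʳ B x = refl
  eval-axiom E-⊕ ()
  eval-axiom (arrow-cong p) (here x) = cong here (E.eval-≈ p x)
  eval-axiom arrow-id (here x) = refl
  eval-axiom arrow-∘ (here x) = refl
  eval-axiom (filter-merge {f} {U}) (here x) =
    trans (cong (eval (J [ type f ++ U ])) (evalFilter-does em V f U x)) (merge-branch (passes f (proj₁ (All.++⁻ (type f) x))))
    where
    merge-branch : ∀ b → eval (J [ type f ++ U ]) (branch b x) ≡ here x
    merge-branch true  = refl
    merge-branch false = refl
  eval-axiom (filter-comm {f} {g} {T} {π = π} {ρ}) (here x)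
    with eval-filterAt f π x | eval-filterAt g ρ x
  ... | a , p | b , q =
    -- Neither filter changes the row, so the outcomes `a` and `b` are the same in either order.
    -- They index the four output tables, and the middle symmetry exchanges the roles of the two
    -- bits.
    trans (eval-⊕-⊕ (filterAt f π) (filterAt g ρ) a p q)
      (sym (trans (cong (eval (id {[ T ]} ⊕ σ [ T ] [ T ] ⊕ id {[ T ]})) (eval-⊕-⊕ (filterAt g ρ) (filterAt f π) b q p))
        (swap-middle a b)))
    where
    either : Bool → ⟨ T ∷ T ∷ [] ⟩ → ⟨ T ∷ T ∷ T ∷ T ∷ [] ⟩
    either a y = if a then Any.++⁺ˡ y else Any.++⁺ʳ (T ∷ T ∷ []) y

    eval-⊕-⊕ : ∀ (d e : Hom [ T ] (T ∷ T ∷ [])) a {b} →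
               eval d (here x) ≡ branch a x → eval e (here x) ≡ branch b x →
               eval ((e ⊕ e) ∘ d) (here x) ≡ either a (branch b x)
    eval-⊕-⊕ d e true  p q = trans (cong (eval (e ⊕ e)) p) (cong (either true) q)
    eval-⊕-⊕ d e false p q = trans (cong (eval (e ⊕ e)) p) (cong (either false) q)

    swap-middle : ∀ a b → eval (id {[ T ]} ⊕ σ [ T ] [ T ] ⊕ id {[ T ]}) (either b (branch a x)) ≡
                          either a (branch b x)
    swap-middle true  true  = refl
    swap-middle true  false = refl
    swap-middle false true  = refl
    swap-middle false false = refl
  eval-axiom (filter-disjoint {f} {U} {W} {h}) (here x) =
    filter-natural f (E.id {type f} E.× h) (λ y z → evalᴱ V h z)
      (λ y z → E.eval-× E.id h y z) x
  eval-axiom (filter-copy {f} {U}) (here x) =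
    filter-natural f (copyFilterColumns f U) All.++⁺
      (λ y z → trans (cong (evalᴱ V (E.α F F U)) (E.eval-× (E.δ F) E.id y z)) (E.eval-α y y z)) x
    where
    F : E.Obj
    F = type f
  eval-axiom (filter-preserveʳ {f} {U}) (here x) = by-cases _ (evalFilter-does em V f U x)
    where
    X : E.Obj
    X = type f ++ U
    skip : Hom (X ∷ X ∷ []) (X ∷ X ∷ X ∷ [])
    skip = id {[ X ]} ⊕ E₀ [ X ] ⊕ id {[ X ]}
    by-cases : ∀ b → eval [ f × U ] (here x) ≡ branch b x →
               eval ((id {[ X ]} ⊕ [ f × U ]) ∘ [ f × U ]) (here x) ≡ eval (skip ∘ [ f × U ]) (here x)
    by-cases true  p = trans (cong (eval (id {[ X ]} ⊕ [ f × U ])) p) (sym (cong (eval skip) p))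
    by-cases false p = trans (cong (eval (id {[ X ]} ⊕ [ f × U ])) p)
      -- The second filter sees the same row, so `p` settles its outcome too.
      (trans (cong there p) (sym (cong (eval skip) p)))
  eval-axiom (filter-preserveˡ {f} {U}) (here x) = by-cases _ (evalFilter-does em V f U x)
    where
    X : E.Obj
    X = type f ++ U
    skip : Hom (X ∷ X ∷ []) (X ∷ X ∷ X ∷ [])
    skip = id {[ X ]} ⊕ E₀ [ X ] ⊕ id {[ X ]}
    by-cases : ∀ b → eval [ f × U ] (here x) ≡ branch b x →
               eval (([ f × U ] ⊕ id {[ X ]}) ∘ [ f × U ]) (here x) ≡ eval (skip ∘ [ f × U ]) (here x)
    by-cases true  p = trans (cong (eval ([ f × U ] ⊕ id {[ X ]})) p)
      (trans (cong Any.++⁺ˡ p) (sym (cong (eval skip) p)))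
    by-cases false p = trans (cong (eval ([ f × U ] ⊕ id {[ X ]})) p) (sym (cong (eval skip) p))

  eval-≈ : ∀ {A B} {d e : Hom A B} → d ≈ e → ∀ x → eval d x ≡ eval e x
  eval-≈ (axiom p) x = eval-axiom p x
  eval-≈ ≈-refl x = refl
  eval-≈ (≈-sym p) x = sym (eval-≈ p x)
  eval-≈ (≈-trans p q) x = trans (eval-≈ p x) (eval-≈ q x)
  eval-≈ (∘-cong {f′ = f′} p q) x = trans (eval-≈ p _) (cong (eval f′) (eval-≈ q x))
  eval-≈ (⊗-cong {A = A} {B = B} p q) x with Any.++⁻ A x
  ... | inj₁ y = cong Any.++⁺ˡ (eval-≈ p y)
  ... | inj₂ y = cong (Any.++⁺ʳ B) (eval-≈ q y)
  eval-≈ identityˡ x = refl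
  eval-≈ identityʳ x = refl
  eval-≈ assoc x = refl
  eval-≈ (⊗-id {A}) x = Any.++⁺∘++⁻ A x
  eval-≈ (⊗-∘ {A} {f = f} {h} {f′} {h′}) = Any-++-elim A _
    (λ y → trans (eval-⊕ˡ (f ∘ h) (f′ ∘ h′) y)
      (sym (trans (cong (eval (f ⊕ f′)) (eval-⊕ˡ h h′ y)) (eval-⊕ˡ f f′ (eval h y)))))
    (λ y → trans (eval-⊕ʳ (f ∘ h) (f′ ∘ h′) y)
      (sym (trans (cong (eval (f ⊕ f′)) (eval-⊕ʳ h h′ y)) (eval-⊕ʳ f f′ (eval h′ y)))))
  eval-≈ (⊗-assoc {A} {B} {C} {A′} {B′} {C′} {f} {h} {k}) = elim₃ A B C _ case₁ case₂ case₃
    where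
    l : Hom ((A ++ B) ++ C) (A′ ++ (B′ ++ C′))
    l = α A′ B′ C′ ∘ ((f ⊕ h) ⊕ k)
    r : Hom ((A ++ B) ++ C) (A′ ++ (B′ ++ C′))
    r = (f ⊕ (h ⊕ k)) ∘ α A B C
    case₁ : ∀ x → eval l (first A B C x) ≡ eval r (first A B C x)
    case₁ x rewrite eval-⊕ˡ (f ⊕ h) k (Any.++⁺ˡ x) | eval-⊕ˡ f h x | eval-α₁ A B C x
      | eval-⊕ˡ f (h ⊕ k) x = eval-α₁ A′ B′ C′ (eval f x)
    case₂ : ∀ x → eval l (second A B C x) ≡ eval r (second A B C x)
    case₂ x rewrite eval-⊕ˡ (f ⊕ h) k (Any.++⁺ʳ A x) | eval-⊕ʳ f h x | eval-α₂ A B C x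
      | eval-⊕ʳ f (h ⊕ k) (Any.++⁺ˡ x) | eval-⊕ˡ h k x = eval-α₂ A′ B′ C′ (eval h x)
    case₃ : ∀ x → eval l (third A B C x) ≡ eval r (third A B C x)
    case₃ x rewrite eval-⊕ʳ (f ⊕ h) k x | eval-α₃ A B C x
      | eval-⊕ʳ f (h ⊕ k) (Any.++⁺ʳ B x) | eval-⊕ʳ h k x = eval-α₃ A′ B′ C′ (eval k x)
  eval-≈ ⊗-unitˡ x = refl
  eval-≈ (⊗-unitʳ {A} {B} {f}) = Any-++-elim A _
    (λ x → trans (cong (eval (ρ B)) (eval-⊕ˡ f id x))
      (trans (eval-ρ B (eval f x)) (cong (eval f) (sym (eval-ρ A x))))) λ ()
  eval-≈ (σ-natural {A} {B} {C} {D} {f} {h}) = Any-++-elim A _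
    (λ x → trans (cong (eval (σ B D)) (eval-⊕ˡ f h x)) (trans (eval-σˡ B D (eval f x))
      (sym (trans (cong (eval (h ⊕ f)) (eval-σˡ A C x)) (eval-⊕ʳ h f x)))))
    (λ x → trans (cong (eval (σ B D)) (eval-⊕ʳ f h x)) (trans (eval-σʳ B D (eval h x))
      (sym (trans (cong (eval (h ⊕ f)) (eval-σʳ A C x)) (eval-⊕ˡ h f x)))))
  eval-≈ (σ-involutive {A} {B}) = Any.++-comm∘++-comm A
  eval-≈ (σ-unit {A}) = Any-++-elim A _ (λ x → trans (eval-σˡ A [] x) (sym (eval-ρ A x))) λ ()
  eval-≈ (σ-hexagon {A} {B} {C}) = elim₃ A B C _ case₁ case₂ case₃
    where
    l : Hom ((A ++ B) ++ C) (B ++ (C ++ A))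
    l = α B C A ∘ σ A (B ++ C) ∘ α A B C
    r : Hom ((A ++ B) ++ C) (B ++ (C ++ A))
    r = (id {B} ⊕ σ A C) ∘ α B A C ∘ (σ A B ⊕ id {C})
    case₁ : ∀ x → eval l (first A B C x) ≡ eval r (first A B C x)
    case₁ x rewrite eval-α₁ A B C x | eval-σˡ A (B ++ C) x | eval-α₃ B C A x
      | eval-⊕ˡ (σ A B) (id {C}) (Any.++⁺ˡ x) | eval-σˡ A B x | eval-α₂ B A C x
      | eval-⊕ʳ (id {B}) (σ A C) (Any.++⁺ˡ x) | eval-σˡ A C x = refl
    case₂ : ∀ x → eval l (second A B C x) ≡ eval r (second A B C x)
    case₂ x rewrite eval-α₂ A B C x | eval-σʳ A (B ++ C) (Any.++⁺ˡ x) | eval-α₁ B C A x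
      | eval-⊕ˡ (σ A B) (id {C}) (Any.++⁺ʳ A x) | eval-σʳ A B x | eval-α₁ B A C x
      | eval-⊕ˡ (id {B}) (σ A C) x = refl
    case₃ : ∀ x → eval l (third A B C x) ≡ eval r (third A B C x)
    case₃ x rewrite eval-α₃ A B C x | eval-σʳ A (B ++ C) (Any.++⁺ʳ B x) | eval-α₂ B C A x
      | eval-⊕ʳ (σ A B) (id {C}) x | eval-α₃ B A C x
      | eval-⊕ʳ (id {B}) (σ A C) (Any.++⁺ʳ A x) | eval-σʳ A C x = refl

-- Completeness

module DecisionTrees {ℓ : Level} (em : ExcludedMiddle ℓ) (S : Signature ℓ) (T : ℰ.Obj S) where
  open Signature S
  private
    module E where
      open ℰ S public
      open ℰProperties S public
  open Terms S T
  open ℱ S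
  open ℱProperties S
  open HomReasoning

  -- Decision trees and symbolic evaluation

  Test : Set ℓ
  Test = Σ Filter λ f → Terms (type f)

  Row : Obj → Set ℓ
  Row = Any Terms

  data Tree (B : Obj) : Set ℓ where
    leaf : Row B → Tree B
    node : Test → Tree B → Tree B → Tree B

  infixl 1 _>>=_

  _>>=_ : ∀ {B C} → Tree B → (Row B → Tree C) → Tree C
  leaf x     >>= k = k x
  node c l r >>= k = node c (l >>= k) (r >>= k)

  run : ∀ {B} → (Test → Bool) → Tree B → Row B
  run P (leaf x)     = x
  run P (node c l r) = if P c then run P l else run P r

  run->>= : ∀ {B C} P (t : Tree B) (k : Row B → Tree C) → run P (t >>= k) ≡ run P (k (run P t))
  run->>= P (leaf x)     k = refl
  run->>= P (node c l r) k with P c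
  ... | true  = run->>= P l k
  ... | false = run->>= P r k

  predicate : (Test → Bool) → ∀ f → Pred (Terms (type f)) ℓ
  predicate P f x = Lift ℓ (P (f , x) ≡ true)

  valuation : (Test → Bool) → Valuation S
  valuation P = model (predicate P)

  -- Symbolic execution on rows of terms: a filter branches on its test instead of deciding it, so
  -- the tree refers to no particular valuation of the filters.
  normalise : ∀ {A B} → Hom A B → Row A → Tree B
  -- Any choice of tests would serve here, since morphisms of ℰ never consult the filters.
  normalise (gen (arrow h)) (here x)    = leaf (here (evalᴱ (valuation λ _ → false) h x))
  normalise (gen (filter f U)) (here x) =
    node (f , proj₁ (All.++⁻ (type f) x)) (leaf (here x)) (leaf (there (here x)))
  normalise (gen (merge A)) x           = leaf (Sum.reduce (Any.++⁻ A x))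
  normalise (gen (empty A)) ()
  normalise id x                        = leaf x
  normalise (d ∘ e) x                   = normalise e x >>= normalise d
  normalise (_⊕_ {A = A} {B = B} d e) x =
    [ (λ y → normalise d y >>= λ z → leaf (Any.++⁺ˡ z))
    , (λ y → normalise e y >>= λ z → leaf (Any.++⁺ʳ B z)) ]′ (Any.++⁻ A x)
  normalise (σ A B) x                   = leaf ([ Any.++⁺ʳ B , Any.++⁺ˡ ]′ (Any.++⁻ A x))

  -- Turns agreement of two diagrams in all term valuations into agreement of two fixed trees under
  -- all choices `P`.
  run-normalise : ∀ {A B} P (d : Hom A B) (x : Row A) →
                  evalᶠ (valuation P) em d x ≡ run P (normalise d x)
  run-normalise P (gen (arrow h)) (here x) = cong here (evalᴱ-filter-irrelevant _ _ h x)
  run-normalise P (gen (filter f U)) (here x) =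
    trans (evalFilter-does em (valuation P) f U x)
      (cong (λ b → if b then here x else there (here x)) (does-em-≡true em (P _)))
  run-normalise P (gen (merge A)) x = refl
  run-normalise P id x = refl
  run-normalise P (d ∘ e) x =
    trans (run-normalise P d _)
      (trans (cong (λ y → run P (normalise d y)) (run-normalise P e x))
        (sym (run->>= P (normalise e x) (normalise d))))
  run-normalise P (_⊕_ {A = A} {B = B} d e) x with Any.++⁻ A x
  ... | inj₁ y = trans (cong Any.++⁺ˡ (run-normalise P d y)) (sym (run->>= P (normalise d y) _))
  ... | inj₂ y = trans (cong (Any.++⁺ʳ B) (run-normalise P e y)) (sym (run->>= P (normalise e y) _))
  run-normalise P (σ A B) x = refl

  -- Trees as morphisms of ℱ

  inject : ∀ {B} → Row B → Hom [ T ] B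
  -- A coproduct injection after `⟦ ⌜ x ⌝ ⟧`: every table other than the selected one is empty.
  inject {_ ∷ B} (here x)  = ⟦ ⌜ x ⌝ ⟧ ⊕ E₀ B
  inject {U ∷ B} (there x) = E₀ [ U ] ⊕ inject x

  ⌊_⌋ᵗ : ∀ {B} → Tree B → Hom [ T ] B
  ⌊ leaf x ⌋ᵗ           = inject x
  ⌊ node (f , x) l r ⌋ᵗ = choose f ⌜ x ⌝ ⌊ l ⌋ᵗ ⌊ r ⌋ᵗ

  inject-++⁺ˡ : ∀ {A B} (x : Row A) → inject (Any.++⁺ˡ {ys = B} x) ≈ inject x ⊕ E₀ B
  inject-++⁺ˡ (here x)  = ≈-trans (⊗-cong ≈-refl (axiom E-⊕)) (≈-sym (unframe ⊗-assoc))
  inject-++⁺ˡ (there x) = ≈-trans (⊗-cong ≈-refl (inject-++⁺ˡ x)) (≈-sym (unframe ⊗-assoc))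

  inject-++⁺ʳ : ∀ A {B} (x : Row B) → inject (Any.++⁺ʳ A x) ≈ E₀ A ⊕ inject x
  inject-++⁺ʳ []      x = ≈-sym (≈-trans (⊗-cong (axiom E-unit) ≈-refl) ⊗-unitˡ)
  inject-++⁺ʳ (U ∷ A) x = ≈-trans (⊗-cong ≈-refl (inject-++⁺ʳ A x))
    (≈-trans (≈-sym (unframe ⊗-assoc)) (⊗-cong (≈-sym (axiom (E-⊕ {[ U ]} {A}))) ≈-refl))

  inject-split : ∀ A {B} (x : Row (A ++ B)) →
                 inject x ≈ [ (λ y → inject y ⊕ E₀ B) , (λ y → E₀ A ⊕ inject y) ]′ (Any.++⁻ A x)
  inject-split A x with Any.++⁻ A x | Any.++⁺∘++⁻ A x
  ... | inj₁ y | refl = inject-++⁺ˡ y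
  ... | inj₂ y | refl = inject-++⁺ʳ A y

  -- Postcomposition passes through conditionals by `choose-∘`, so it is enough to know its effect
  -- on the rows at the leaves.
  ∘-⌊⌋ᵗ : ∀ {B C} (t : Tree B) (d : Hom B C) (k : Row B → Tree C) →
          (∀ x → d ∘ inject x ≈ ⌊ k x ⌋ᵗ) → d ∘ ⌊ t ⌋ᵗ ≈ ⌊ t >>= k ⌋ᵗ
  ∘-⌊⌋ᵗ (leaf x)     d k p = p x
  ∘-⌊⌋ᵗ (node c l r) d k p = ≈-trans (choose-∘ d) (choose-cong (∘-⌊⌋ᵗ l d k p) (∘-⌊⌋ᵗ r d k p))

  -- The left coproduct injection. It presents `_⊕ E₀ B` as a postcomposition, the form that `∘-⌊⌋ᵗ`
  -- can push to the leaves.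
  ι₁ : ∀ A B → Hom A (A ++ B)
  ι₁ A B = (id {A} ⊕ E₀ B) ∘ coe (sym (++-identityʳ A))

  ι₁-∘ : ∀ {A} B (d : Hom [ T ] A) → ι₁ A B ∘ d ≈ d ⊕ E₀ B
  ι₁-∘ {A} B d = begin
    ι₁ A B ∘ d
      ≈⟨ assoc ⟩
    (id ⊕ E₀ B) ∘ coe (sym (++-identityʳ A)) ∘ d
      ≈⟨ refl⟩∘⟨ refl⟩∘⟨ ≈-trans ⊗-unitʳ identityʳ ⟨
    (id ⊕ E₀ B) ∘ coe (sym (++-identityʳ A)) ∘ ρ A ∘ (d ⊕ id {[]})
      ≈⟨ refl⟩∘⟨ cancelˡ (coe-sym (++-identityʳ A)) ⟩
    (id ⊕ E₀ B) ∘ (d ⊕ id {[]})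
      ≈⟨ ⊗-merge identityˡ identityʳ ⟩
    d ⊕ E₀ B ∎

  ι₂ : ∀ A B → Hom B (A ++ B)
  ι₂ A B = E₀ A ⊕ id {B}

  ι₂-∘ : ∀ A {B} (d : Hom [ T ] B) → ι₂ A B ∘ d ≈ E₀ A ⊕ d
  ι₂-∘ A {B} d = begin
    ι₂ A B ∘ d                 ≈⟨ refl⟩∘⟨ ⊗-unitˡ ⟨
    ι₂ A B ∘ (id {[]} ⊕ d)     ≈⟨ ⊗-merge identityʳ identityˡ ⟩
    E₀ A ⊕ d                   ∎

  σ-⊕E : ∀ {A} B (d : Hom [ T ] A) → σ A B ∘ (d ⊕ E₀ B) ≈ E₀ B ⊕ d
  σ-⊕E B d = ≈-trans σ-natural (elimʳ σ-unit)

  σ-E⊕ : ∀ A {B} (d : Hom [ T ] B) → σ A B ∘ (E₀ A ⊕ d) ≈ d ⊕ E₀ A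
  σ-E⊕ A d = ≈-trans σ-natural (elimʳ (≈-trans (≈-sym identityʳ) σ-[]ˡ))

  -- Arrows rest on `⌜evalᴱ⌝` and filters on `filter-⟨⟩`; in a composite the outer morphism acts
  -- leaf by leaf on the tree of the inner one.
  ∘-inject : ∀ {A B} (d : Hom A B) (x : Row A) → d ∘ inject x ≈ ⌊ normalise d x ⌋ᵗ
  ∘-inject (gen (arrow h)) (here x) = begin
    ⟦ h ⟧ ∘ (⟦ ⌜ x ⌝ ⟧ ⊕ E₀ [])  ≈⟨ refl⟩∘⟨ ⊕-E-[] _ ⟩
    ⟦ h ⟧ ∘ ⟦ ⌜ x ⌝ ⟧            ≈⟨ arrow-merge (⌜evalᴱ⌝ _ h x) ⟩
    ⟦ ⌜ _ ⌝ ⟧                    ≈⟨ ⊕-E-[] _ ⟨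
    ⟦ ⌜ _ ⌝ ⟧ ⊕ E₀ []            ∎
  ∘-inject (gen (filter f U)) (here x) = begin
    [ f × U ] ∘ (⟦ ⌜ x ⌝ ⟧ ⊕ E₀ [])
      ≈⟨ refl⟩∘⟨ ≈-trans (⊕-E-[] _) x≈tu ⟩
    [ f × U ] ∘ ⟦ tu ⟧
      ≈⟨ filter-⟨⟩ f _ _ ⟩
    (⟦ tu ⟧ ⊕ ⟦ tu ⟧) ∘ test f t
      ≈⟨ ⊗-cong x≈tu x≈tu ⟩∘⟨refl ⟨
    (⟦ ⌜ x ⌝ ⟧ ⊕ ⟦ ⌜ x ⌝ ⟧) ∘ test f t
      -- The pair of output tables is split into a merge of two injected rows, one for each leaf.
      ≈⟨ pullˡ (J-⊕E-E⊕ ⟦ ⌜ x ⌝ ⟧ ⟦ ⌜ x ⌝ ⟧) ⟨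
    choose f t (⟦ ⌜ x ⌝ ⟧ ⊕ E₀ [ X ]) (E₀ [ X ] ⊕ ⟦ ⌜ x ⌝ ⟧)
      ≈⟨ choose-cong ≈-refl (⊗-cong ≈-refl (⊕-E-[] _)) ⟨
    choose f t (⟦ ⌜ x ⌝ ⟧ ⊕ E₀ [ X ]) (E₀ [ X ] ⊕ (⟦ ⌜ x ⌝ ⟧ ⊕ E₀ [])) ∎
    where
    X : E.Obj
    X = type f ++ U
    t : E.Hom T (type f)
    t = ⌜ proj₁ (All.++⁻ (type f) x) ⌝
    tu : E.Hom T X
    tu = E.⟨ t , ⌜ proj₂ (All.++⁻ (type f) x) ⌝ ⟩
    x≈tu : ⟦ ⌜ x ⌝ ⟧ ≈ ⟦ tu ⟧
    x≈tu = axiom (arrow-cong (⌜⌝-split (type f) x))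
  ∘-inject (gen (merge A)) x with Any.++⁻ A x | inject-split A x
  ... | inj₁ y | p = ≈-trans (refl⟩∘⟨ p) (J-⊕E _)
  ... | inj₂ y | p = ≈-trans (refl⟩∘⟨ p) (J-E⊕ _)
  ∘-inject id x = identityˡ
  ∘-inject (d ∘ e) x = ≈-trans assoc
    (≈-trans (refl⟩∘⟨ ∘-inject e x) (∘-⌊⌋ᵗ (normalise e x) d (normalise d) (∘-inject d)))
  ∘-inject (_⊕_ {A = A} {B = B} {C = C} {D = D} d e) x with Any.++⁻ A x | inject-split A x
  ... | inj₁ y | p = begin
    (d ⊕ e) ∘ inject x               ≈⟨ refl⟩∘⟨ p ⟩
    (d ⊕ e) ∘ (inject y ⊕ E₀ C)      ≈⟨ ⊗-merge (∘-inject d y) (axiom E-natural) ⟩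
    ⌊ normalise d y ⌋ᵗ ⊕ E₀ D        ≈⟨ ι₁-∘ D _ ⟨
    ι₁ B D ∘ ⌊ normalise d y ⌋ᵗ
      ≈⟨ ∘-⌊⌋ᵗ (normalise d y) _ _ (λ z → ≈-trans (ι₁-∘ D _) (≈-sym (inject-++⁺ˡ z))) ⟩
    ⌊ (normalise d y >>= λ z → leaf (Any.++⁺ˡ z)) ⌋ᵗ ∎
  ... | inj₂ y | p = begin
    (d ⊕ e) ∘ inject x               ≈⟨ refl⟩∘⟨ p ⟩
    (d ⊕ e) ∘ (E₀ A ⊕ inject y)      ≈⟨ ⊗-merge (axiom E-natural) (∘-inject e y) ⟩
    E₀ B ⊕ ⌊ normalise e y ⌋ᵗ        ≈⟨ ι₂-∘ B _ ⟨
    ι₂ B D ∘ ⌊ normalise e y ⌋ᵗ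
      ≈⟨ ∘-⌊⌋ᵗ (normalise e y) _ _ (λ z → ≈-trans (ι₂-∘ B _) (≈-sym (inject-++⁺ʳ B z))) ⟩
    ⌊ (normalise e y >>= λ z → leaf (Any.++⁺ʳ B z)) ⌋ᵗ ∎
  ∘-inject (σ A B) x with Any.++⁻ A x | inject-split A x
  ... | inj₁ y | p = ≈-trans (refl⟩∘⟨ p) (≈-trans (σ-⊕E B _) (≈-sym (inject-++⁺ʳ B y)))
  ... | inj₂ y | p = ≈-trans (refl⟩∘⟨ p) (≈-trans (σ-E⊕ A _) (≈-sym (inject-++⁺ˡ y)))

  -- Restricting trees to one outcome of a test

  _[_≔_] : (Test → Bool) → Test → Bool → Test → Bool
  (P [ c ≔ b ]) c′ = if does (em {c′ ≡ c}) then b else P c′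

  restrict : ∀ {B} → Test → Bool → Tree B → Tree B
  restrict c b (leaf x)      = leaf x
  restrict c b (node c′ l r) with em {c′ ≡ c}
  ... | yes _ = if b then restrict c b l else restrict c b r
  ... | no _  = node c′ (restrict c b l) (restrict c b r)

  -- Carries the hypothesis of `run-injective` over to restricted trees: the choice `P` is answered
  -- by the choice modified at `c`.
  run-restrict : ∀ {B} P c b (t : Tree B) → run P (restrict c b t) ≡ run (P [ c ≔ b ]) t
  run-restrict P c b (leaf x) = refl
  run-restrict P c b (node c′ l r) with em {c′ ≡ c}
  run-restrict P c true  (node c′ l r) | yes _ = run-restrict P c true l
  run-restrict P c false (node c′ l r) | yes _ = run-restrict P c false r
  run-restrict P c b (node c′ l r) | no _ with P c′
  ... | true  = run-restrict P c b l
  ... | false = run-restrict P c b r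

  size : ∀ {B} → Tree B → ℕ
  size (leaf _)     = 0
  size (node _ l r) = suc (size l + size r)

  size-restrict : ∀ {B} c b (t : Tree B) → size (restrict c b t) ≤ size t
  size-restrict c b (leaf x) = z≤n
  size-restrict c b (node c′ l r) with em {c′ ≡ c}
  size-restrict c true  (node c′ l r) | yes _ =
    m≤n⇒m≤1+n (m≤n⇒m≤n+o (size r) (size-restrict c true l))
  size-restrict c false (node c′ l r) | yes _ =
    m≤n⇒m≤1+n (m≤n⇒m≤o+n (size l) (size-restrict c false r))
  size-restrict c b (node c′ l r) | no _ =
    s≤s (+-mono-≤ (size-restrict c b l) (size-restrict c b r))

  -- The decrease is strict because the root node itself is deleted; this drives the induction in
  -- `run-injective`.
  size-restrict-root : ∀ {B} c b (l r : Tree B) → size (restrict c b (node c l r)) < size (node c l r)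
  size-restrict-root c b l r with em {c ≡ c}
  size-restrict-root c true  l r | yes _ = s≤s (m≤n⇒m≤n+o (size r) (size-restrict c true l))
  size-restrict-root c false l r | yes _ = s≤s (m≤n⇒m≤o+n (size l) (size-restrict c false r))
  size-restrict-root c b l r | no c≢c = contradiction refl c≢c

  -- Puts `m` on the side where the test has outcome `b`, so that both sides of a conditional are
  -- treated by one statement.
  assume : ∀ {B} → Test → Bool → Hom [ T ] B → Hom [ T ] B → Hom [ T ] B
  assume (f , x) true  m n = choose f ⌜ x ⌝ m n
  assume (f , x) false m n = choose f ⌜ x ⌝ n m

  -- At a node testing `c` again, absorption removes the branch that cannot be reached. At another
  -- test, `choose-idem` doubles `n` so that `choose-comm` can carry `c` below that test; after the
  -- two recursive calls both moves are undone.
  assume-restrict : ∀ {B} c b (t : Tree B) (n : Hom [ T ] B) →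
                    assume c b ⌊ t ⌋ᵗ n ≈ assume c b ⌊ restrict c b t ⌋ᵗ n
  assume-restrict c b (leaf x) n = ≈-refl
  assume-restrict c b (node c′ l r) n with em {c′ ≡ c}
  assume-restrict c true  (node c′ l r) n | yes refl =
    ≈-trans choose-absorbˡ (assume-restrict c true l n)
  assume-restrict c false (node c′ l r) n | yes refl =
    ≈-trans choose-absorbʳ (assume-restrict c false r n)
  assume-restrict c true (node c′ l r) n | no _ = begin
    assume c true (assume c′ true ⌊ l ⌋ᵗ ⌊ r ⌋ᵗ) n
      ≈⟨ choose-cong ≈-refl choose-idem ⟨
    assume c true (assume c′ true ⌊ l ⌋ᵗ ⌊ r ⌋ᵗ) (assume c′ true n n)
      ≈⟨ choose-comm ⟩
    assume c′ true (assume c true ⌊ l ⌋ᵗ n) (assume c true ⌊ r ⌋ᵗ n)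
      ≈⟨ choose-cong (assume-restrict c true l n) (assume-restrict c true r n) ⟩
    assume c′ true (assume c true ⌊ restrict c true l ⌋ᵗ n) (assume c true ⌊ restrict c true r ⌋ᵗ n)
      ≈⟨ choose-comm ⟨
    assume c true (assume c′ true ⌊ restrict c true l ⌋ᵗ ⌊ restrict c true r ⌋ᵗ) (assume c′ true n n)
      ≈⟨ choose-cong ≈-refl choose-idem ⟩
    assume c true (assume c′ true ⌊ restrict c true l ⌋ᵗ ⌊ restrict c true r ⌋ᵗ) n ∎
  assume-restrict c false (node c′ l r) n | no _ = begin
    assume c false (assume c′ true ⌊ l ⌋ᵗ ⌊ r ⌋ᵗ) n
      ≈⟨ choose-cong choose-idem ≈-refl ⟨
    assume c false (assume c′ true ⌊ l ⌋ᵗ ⌊ r ⌋ᵗ) (assume c′ true n n)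
      ≈⟨ choose-comm ⟩
    assume c′ true (assume c false ⌊ l ⌋ᵗ n) (assume c false ⌊ r ⌋ᵗ n)
      ≈⟨ choose-cong (assume-restrict c false l n) (assume-restrict c false r n) ⟩
    assume c′ true (assume c false ⌊ restrict c false l ⌋ᵗ n) (assume c false ⌊ restrict c false r ⌋ᵗ n)
      ≈⟨ choose-comm ⟨
    assume c false (assume c′ true ⌊ restrict c false l ⌋ᵗ ⌊ restrict c false r ⌋ᵗ) (assume c′ true n n)
      ≈⟨ choose-cong choose-idem ≈-refl ⟩
    assume c false (assume c′ true ⌊ restrict c false l ⌋ᵗ ⌊ restrict c false r ⌋ᵗ) n ∎

  -- Shannon expansion, obtained by duplicating `t` and restricting each copy under its own outcome;
  -- `c` may be any test, whether or not it occurs in `t`.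
  expand : ∀ {B} c (t : Tree B) → ⌊ t ⌋ᵗ ≈ assume c true ⌊ restrict c true t ⌋ᵗ ⌊ restrict c false t ⌋ᵗ
  expand c t = ≈-trans (≈-sym choose-idem)
    (≈-trans (assume-restrict c true t _) (assume-restrict c false t _))

  -- The bound `n` serves as fuel: restricted trees are not subterms of the originals, so the
  -- recursion follows the total size.
  run-injective : ∀ {B} n (t u : Tree B) → size t + size u ≤ n →
                  (∀ P → run P t ≡ run P u) → ⌊ t ⌋ᵗ ≈ ⌊ u ⌋ᵗ

  run-injective-by : ∀ {B} n c (t u : Tree B) →
                     (∀ b → size (restrict c b t) + size (restrict c b u) ≤ n) →
                     (∀ P → run P t ≡ run P u) → ⌊ t ⌋ᵗ ≈ ⌊ u ⌋ᵗ
  run-injective-by n c t u smaller eq =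
    ≈-trans (expand c t) (≈-trans (choose-cong (branch true) (branch false)) (≈-sym (expand c u)))
    where
    branch : ∀ b → ⌊ restrict c b t ⌋ᵗ ≈ ⌊ restrict c b u ⌋ᵗ
    branch b = run-injective n (restrict c b t) (restrict c b u) (smaller b) λ P →
      trans (run-restrict P c b t) (trans (eq (P [ c ≔ b ])) (sym (run-restrict P c b u)))

  -- Leaves ignore the choice, so any one of them gives equality of the rows.
  run-injective n (leaf x) (leaf y) p eq with refl ← eq (λ _ → true) = ≈-refl
  -- The expansion uses the root of `u`; restriction fixes the leaf, so `u` alone supplies the
  -- decrease.
  run-injective (suc n) (leaf x) u@(node c l r) p eq =
    run-injective-by n c (leaf x) u (λ b → s≤s⁻¹ (≤-trans (size-restrict-root c b l r) p)) eq
  run-injective (suc n) t@(node c l r) u p eq =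
    run-injective-by n c t u
      (λ b → s≤s⁻¹ (≤-trans (+-mono-≤ (size-restrict-root c b l r) (size-restrict c b u)) p)) eq

  completeness : ∀ {B} (d d′ : Hom [ T ] B) →
                 (∀ V (x : ⟦_⟧ᶠ V [ T ]) → evalᶠ V em d x ≡ evalᶠ V em d′ x) → d ≈ d′
  completeness d d′ eq = begin
    d                        ≈⟨ elimʳ inject-x ⟨
    d ∘ inject x             ≈⟨ ∘-inject d x ⟩
    ⌊ normalise d x ⌋ᵗ       ≈⟨ run-injective _ (normalise d x) (normalise d′ x) ≤-refl (λ P →
                                  trans (sym (run-normalise P d x))
                                    (trans (eq (valuation P) x) (run-normalise P d′ x))) ⟩
    ⌊ normalise d′ x ⌋ᵗ      ≈⟨ ∘-inject d′ x ⟨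
    d′ ∘ inject x            ≈⟨ elimʳ inject-x ⟩
    d′                       ∎
    where
    x : Row [ T ]
    -- The generic row: its injection is the identity of `[ T ]`, so the tree at this one row
    -- represents the whole diagram.
    x = here (All.tabulate var)

    inject-x : inject x ≈ id
    inject-x = ≈-trans (⊕-E-[] _) (≈-trans (axiom (arrow-cong ⌜variables⌝)) (axiom arrow-id))

theorem1 : ∀ {ℓ} (em : ExcludedMiddle ℓ) (S : Signature ℓ) →
    ∀ (A B : ℰ.Obj S) (d d′ : ℱ.Hom S [ A ] [ B ]) →
    ℱ._≈_ S d d′ ⇔
    (∀ (V : Valuation S) (x : ⟦_⟧ᶠ V [ A ]) → evalᶠ V em d x ≡ evalᶠ V em d′ x)
theorem1 em S A B d d′ = mk⇔
  (λ p V → ℱSoundness.eval-≈ em V p)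
  (DecisionTrees.completeness em S A d d′)
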